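{- Let $G$ be a connected graph of order $n\geq 3$ with block decomposition $B_1,B_2,\ldots,B_q$ (that is, $B_1,\dots,B_q$ are the blocks of $G$). Let $\mathcal{C}$ be the set of those blocks $X$ of $G$ such that either $X$ is a cycle of order at least $4$ or $4\leq |V(X)|\leq 6$, and let $\mathcal{D}$ be the set of those blocks $X$ of $G$ such that $X$ is not a cycle and $|V(X)|\geq 7$. Then $rx_3(G)\leq n-|\mathcal{C}|-2|\mathcal{D}|-1$. Moreover, the upper bound is tight: there exists a connected graph $G$ of order $n\ge 3$ for which equality holds.
   Context: All graphs are finite, simple and undirected. A block of $G$ is a maximal connected subgraph without a cut vertex of its own (so each block of a connected graph of order at least $2$ is either $K_2$ or a $2$-connected graph). Edge colorings are arbitrary (adjacent edges may receive the same color). In an edge-colored graph $G$, a tree $T\subseteq G$ (a subgraph that is a tree) is a rainbow tree if no two edges of $T$ have the same color. For a connected graph $G$ of order $n\ge 3$, a $3$-rainbow coloring of $G$ is an edge coloring such that for every set $S$ of $3$ vertices of $G$ there is a rainbow tree $T$ in $G$ with $S\subseteq V(T)$. The $3$-rainbow index $rx_3(G)$ is the minimum number of colors in a $3$-rainbow coloring of $G$. -}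

module Defs where

open import Data.Bool using (Bool; T)
open import Data.Fin using (Fin; toℕ)
open import Data.Fin.Subset using (Subset; _∈_; _⊆_; Nonempty; ∣_∣)
open import Data.Nat using (ℕ; suc; _≤_)
open import Data.Product using (_×_; _,_; Σ; Σ-syntax; ∃; ∃-syntax)
open import Data.Sum using (_⊎_)
open import Function.Bundles using (_⇔_)
open import Function.Definitions using (Injective)
open import Relation.Binary.Construct.Closure.ReflexiveTransitive using (Star)
open import Relation.Binary.PropositionalEquality using (_≡_; _≢_)
open import Relation.Nullary using (¬_)

-- The vertex set V is an arbitrary subset of the label set Fin N.  A graph and
-- its subgraphs thereby share one type, and the order of a graph is ∣ V ∣, not N.
record Graph (N : ℕ) : Set where
  field
    V          : Subset N
    adj        : Fin N → Fin N → Bool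
    adj-sym    : ∀ {u v} → T (adj u v) → T (adj v u)
    adj-irrefl : ∀ {u} → ¬ T (adj u u)
    adj-V      : ∀ {u v} → T (adj u v) → u ∈ V

  Adj : Fin N → Fin N → Set
  Adj u v = T (adj u v)

  order : ℕ
  order = ∣ V ∣

open Graph public

module _ {N : ℕ} where

  infix 4 _⊑_ _≈_

  -- Not necessarily induced subgraphs.
  record _⊑_ (H G : Graph N) : Set where
    field
      V-⊆   : V H ⊆ V G
      Adj-⊆ : ∀ {u v} → Adj H u v → Adj G u v

  open _⊑_ public

  _≈_ : Graph N → Graph N → Set
  H ≈ K = H ⊑ K × K ⊑ H

  Connected : Graph N → Set
  Connected H = Nonempty (V H) × (∀ {u v} → u ∈ V H → v ∈ V H → Star (Adj H) u v)

  -- Adjacency in the vertex-deleted subgraph H − x.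
  AdjAvoiding : Graph N → Fin N → Fin N → Fin N → Set
  AdjAvoiding H x u v = Adj H u v × u ≢ x × v ≢ x

  -- Deleting x splits a component of H: two vertices other than x are joined in
  -- H but not in H − x.  In particular the vertex of K₁ is not a cut vertex.
  IsCutVertex : Graph N → Fin N → Set
  IsCutVertex H x =
    x ∈ V H ×
    (∃[ u ] ∃[ v ] (u ∈ V H × u ≢ x × v ∈ V H × v ≢ x ×
                    Star (Adj H) u v × ¬ Star (AdjAvoiding H x) u v))

  ConnectedWithoutCutVertex : Graph N → Set
  ConnectedWithoutCutVertex H = Connected H × (∀ x → ¬ IsCutVertex H x)

  IsBlock : Graph N → Graph N → Set
  IsBlock G X =
    X ⊑ G × ConnectedWithoutCutVertex X ×
    (∀ Y → Y ⊑ G → ConnectedWithoutCutVertex Y → X ⊑ Y → Y ⊑ X)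

  -- B lists every block of G exactly once.
  record IsBlockDecomposition (G : Graph N) {q : ℕ} (B : Fin q → Graph N) : Set where
    field
      isBlock  : ∀ i → IsBlock G (B i)
      distinct : ∀ {i j} → B i ≈ B j → i ≡ j
      complete : ∀ X → IsBlock G X → ∃[ i ] B i ≈ X

  -- j is the cyclic successor of i.
  Next : ∀ {m} → Fin m → Fin m → Set
  Next {m} i j = (suc (toℕ i) ≡ toℕ j) ⊎ (suc (toℕ i) ≡ m × toℕ j ≡ 0)

  -- The whole graph H is a cycle c₀ c₁ … cₘ₋₁ c₀ of length m ≥ 3.
  IsCycle : Graph N → Set
  IsCycle H =
    ∃[ m ] (3 ≤ m × Σ[ c ∈ (Fin m → Fin N) ]
      (Injective _≡_ _≡_ c ×
       (∀ v → v ∈ V H ⇔ (∃[ i ] c i ≡ v)) ×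
       (∀ i j → Adj H (c i) (c j) ⇔ (Next i j ⊎ Next j i))))

  IsTree : Graph N → Set
  IsTree H = Connected H × (∀ C → C ⊑ H → ¬ IsCycle C)

  InClassC : Graph N → Set
  InClassC X = (IsCycle X × 4 ≤ order X) ⊎ (4 ≤ order X × order X ≤ 6)

  InClassD : Graph N → Set
  InClassD X = ¬ IsCycle X × 7 ≤ order X

  -- s is the set of indices i for which B i satisfies P.  When B lists distinct
  -- graphs, ∣ s ∣ is therefore the number of graphs in the list satisfying P.
  Selects : ∀ {q} → Subset q → (Fin q → Graph N) → (Graph N → Set) → Set
  Selects s B P = ∀ i → i ∈ s ⇔ P (B i)

  -- Colours come from a palette of k colours, not all of which need occur; the
  -- minimum in IsRainbowIndex₃ is the same as when counting colours that occur.
  record EdgeColoring (G : Graph N) (k : ℕ) : Set where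
    field
      col     : ∀ {u v} → Adj G u v → Fin k
      col-sym : ∀ {u v} (e : Adj G u v) → col (adj-sym G e) ≡ col e

  open EdgeColoring public

  Rainbow : ∀ {G k} → EdgeColoring G k → (H : Graph N) → H ⊑ G → Set
  Rainbow c H H⊑G =
    ∀ {u v x y} (e : Adj H u v) (f : Adj H x y) →
    col c (Adj-⊆ H⊑G e) ≡ col c (Adj-⊆ H⊑G f) →
    (u ≡ x × v ≡ y) ⊎ (u ≡ y × v ≡ x)

  Is3RainbowColoring : ∀ {G k} → EdgeColoring G k → Set
  Is3RainbowColoring {G} c =
    ∀ (S : Subset N) → S ⊆ V G → ∣ S ∣ ≡ 3 →
    Σ[ H ∈ Graph N ] Σ[ H⊑G ∈ H ⊑ G ] (IsTree H × Rainbow c H H⊑G × S ⊆ V H)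

  -- rx₃(G) = r
  IsRainbowIndex₃ : Graph N → ℕ → Set
  IsRainbowIndex₃ G r =
    (Σ[ c ∈ EdgeColoring G r ] Is3RainbowColoring c) ×
    (∀ k (c : EdgeColoring G k) → Is3RainbowColoring c → r ≤ k)

{-# OPTIONS --safe #-}
module Submission where

-- A spanning tree with pairwise different colours gives rx₃ ≤ n − 1, so blocks in 𝒞 must save one
-- further colour and blocks in 𝒟 two.  Savings add up when two graphs are glued at a cut vertex,
-- which reduces the bound to graphs without cut vertices.  They are also inherited from any
-- contraction H of G: undoing the contraction of one edge costs one vertex and one new colour.
--
-- In a graph without cut vertices, a fibre of a contraction that has at least two vertices can be
-- split in two so that the quotient still has no cut vertex.  Starting from a triangle, the quotients
-- are cycles until either G itself turns out to be a cycle or a quotient has a chord cutting off a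
-- triangle.  At order 4 the quotient contains a 4-cycle, which can be coloured 1, 2, 1, 2 and saves
-- one colour.  A chorded cycle is contracted or split further to order 7, where a finite check of
-- all ways of splitting shows that it contains one of seven graphs that need only 4 colours.
-- The bound is attained by K₃.

open import Defs
open import Data.Bool using (Bool; true; false; T; _∧_; _∨_; not; if_then_else_)
open import Data.Bool.ListAction using (any; all)
open import Data.Bool.Properties using (T?; T-∧; T-∨; T-irrelevant)
open import Data.Empty using (⊥; ⊥-elim)
open import Data.Fin using (Fin; zero; suc; toℕ; fromℕ<; opposite; inject₁)
import Data.Fin.Properties as F
open import Data.Fin.Subset
  using (Subset; _∈_; _∉_; _⊆_; Nonempty; ∣_∣; ⁅_⁆; _∪_; _∩_; _-_; inside;
    outside) renaming (⊤ to full; ⊥ to empty)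
import Data.Fin.Subset.Properties as S
import Data.List as List
open import Data.List
  using (List; []; _∷_; map; filter; upTo; concatMap; allFin; length; concat; _++_)
import Data.List.Membership.Propositional as List∈
import Data.List.Membership.Propositional.Properties as List∈
import Data.List.Properties as List
open import Data.List.Relation.Unary.All as All using (All; []; _∷_)
import Data.List.Relation.Unary.All.Properties as All
open import Data.List.Relation.Unary.AllPairs using ([]; _∷_)
open import Data.List.Relation.Unary.Any as Any using (Any; here; there)
import Data.List.Relation.Unary.Any.Properties as Any
open import Data.List.Relation.Unary.Unique.Propositional using (Unique)
import Data.List.Relation.Unary.Unique.Propositional.Properties as Unique
open import Data.Nat
  using (ℕ; zero; suc; _+_; _*_; _∸_; _⊓_; _⊔_; _≤_; _<_; z≤n; s≤s; z<s; s<s; _≤?_; _<?_; _≟_;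
    _≡ᵇ_; _<ᵇ_)
open import Data.Nat.ListAction using (sum)
import Data.Nat.Properties as ℕ
open import Data.Nat.Tactic.RingSolver using (solve-∀)
open import Data.Product using (_×_; _,_; proj₁; proj₂; Σ-syntax; ∃; ∃-syntax; swap)
open import Data.Product.Properties using (≡-dec)
open import Data.Sum using (_⊎_; inj₁; inj₂; [_,_]′)
open import Data.Unit using (tt)
open import Data.Vec using (Vec; []; _∷_; lookup; tabulate; here; there)
import Data.Vec.Properties as V
open import Function using (_∘_; id; case_of_)
open import Function.Bundles using (_⇔_; mk⇔; Equivalence)
open import Function.Definitions using (Injective)
import Relation.Binary.Construct.Closure.ReflexiveTransitive as Star
open import Relation.Binary.Construct.Closure.ReflexiveTransitive
  using (Star; ε; _◅_; _◅◅_; reverse)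
open import Relation.Binary.Definitions using (DecidableEquality; tri<; tri≈; tri>)
open import Relation.Binary.PropositionalEquality
  using (_≡_; _≢_; refl; sym; trans; cong; cong₂; subst; subst₂)
open import Relation.Nullary using (¬_; Dec; yes; no; does; contradiction)
open import Relation.Nullary.Decidable
  using (toSum; _×-dec_; _⊎-dec_; ¬?; map′; toWitness; fromWitness; dec-true; _→-dec_; ⌊_⌋)

-- `Rainbow₃` stands in for rainbow trees: one edge is picked for each colour, and the picked edges
-- only have to connect three terminals. Terminals may coincide, because different vertices can have
-- the same image in a quotient, or can both be replaced by the cut vertex when a graph is cut in
-- two. Trees return only at the end, grown inside the picked edges. Savings are sought in
-- contractions rather than in subgraphs: a graph without cut vertices whose cycles are all long has
-- no subgraph of order 7 without cut vertices, but it has quotients of that order. A quotient may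
-- have more edges than the small coloured graph found in it; those edges receive colours that are
-- never picked. With 7 vertices and 4 colours the difference is 3: one for the spanning tree and
-- two for a block in 𝒟. The rainbow index is a minimum that has to be exhibited, so the existence
-- of a colouring with k colours is decided by exhaustive search over finite tables.

module _ {A : Set} {R : A → A → Set} {P : A → Set} (P? : ∀ x → Dec (P x)) where

  crossing : ∀ {u v} → Star R u v → P u → ¬ P v → ∃[ x ] ∃[ y ] (R x y × P x × ¬ P y)
  crossing ε pu ¬pv = contradiction pu ¬pv
  crossing (_◅_ {u} {w} r rs) pu ¬pv with P? w
  ... | yes pw = crossing rs pw ¬pv
  ... | no ¬pw = u , w , r , pu , ¬pw

-- Vertex elimination: a walk is replaced by one on the nonzero vertices, where
-- passing through zero becomes a single step.
module _ {n : ℕ} (R : Fin (suc n) → Fin (suc n) → Set) where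

  Bypass : Fin n → Fin n → Set
  Bypass i j = R (suc i) (suc j) ⊎ R (suc i) zero × R zero (suc j)

  bypass⁺ : ∀ {i j} → Star Bypass i j → Star R (suc i) (suc j)
  bypass⁺ ε = ε
  bypass⁺ (inj₁ r ◅ rs) = r ◅ bypass⁺ rs
  bypass⁺ (inj₂ (r , r′) ◅ rs) = r ◅ r′ ◅ bypass⁺ rs

  From : Fin (suc n) → Fin n → Set
  From zero    j = ∃[ k ] (R zero (suc k) × Star Bypass k j)
  From (suc i) j = Star Bypass i j

  bypass⁻ : ∀ {x j} → Star R x (suc j) → From x j
  bypass⁻ ε = ε
  bypass⁻ (_◅_ {zero} {zero} r rs) = bypass⁻ rs
  bypass⁻ (_◅_ {zero} {suc k} r rs) = k , r , bypass⁻ rs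
  bypass⁻ (_◅_ {suc i} {zero} r rs) = let (k , r′ , rs′) = bypass⁻ rs in inj₂ (r , r′) ◅ rs′
  bypass⁻ (_◅_ {suc i} {suc k} r rs) = inj₁ r ◅ bypass⁻ rs

  last-step : ∀ {i} → Star R (suc i) zero → ∃[ k ] (Star Bypass i k × R (suc k) zero)
  last-step {i} (_◅_ {_} {zero} r rs) = i , ε , r
  last-step (_◅_ {_} {suc k} r rs) = let (l , rs′ , r′) = last-step rs in l , inj₁ r ◅ rs′ , r′

star? : ∀ {n} {R : Fin n → Fin n → Set} → (∀ i j → Dec (R i j)) → ∀ i j → Dec (Star R i j)
star? {suc n} {R} R? = λ where
    zero zero → yes ε
    zero (suc j) → map′ (λ (_ , r , rs) → r ◅ bypass⁺ R rs) (bypass⁻ R)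
                        (F.any? λ k → R? zero (suc k) ×-dec rec? k j)
    (suc i) zero → map′ (λ (_ , rs , r) → bypass⁺ R rs ◅◅ r ◅ ε) (last-step R)
                        (F.any? λ k → rec? i k ×-dec R? (suc k) zero)
    (suc i) (suc j) → map′ (bypass⁺ R) (bypass⁻ R) (rec? i j)
  where
  rec? : ∀ i j → Dec (Star (Bypass R) i j)
  rec? = star? (λ i j → R? (suc i) (suc j) ⊎-dec (R? (suc i) zero ×-dec R? zero (suc j)))

-- Counting in finite subsets

∣-∣-covers : ∀ {N} h (p : Subset N) (φ : Fin N → ℕ) →
             (∀ {i} → i < h → ∃[ v ] (v ∈ p × φ v ≡ i)) → h ≤ ∣ p ∣
∣-∣-covers zero p φ cover = z≤n
∣-∣-covers (suc h) p φ cover =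
  let (v , v∈p , φv≡h) = cover (ℕ.n<1+n h) in
  ℕ.≤-<-trans
    (∣-∣-covers h (p - v) φ λ {i} i<h →
      let (u , u∈p , φu≡i) = cover (ℕ.m<n⇒m<1+n i<h) in
      u , S.x∈p∧x≢y⇒x∈p-y u∈p (λ u≡v → ℕ.<⇒≢ i<h (trans (sym φu≡i) (trans (cong φ u≡v) φv≡h))) , φu≡i)
    (S.x∈p⇒∣p-x∣<∣p∣ v∈p)

∣p∪q∣+∣p∩q∣ : ∀ {N} (p q : Subset N) → ∣ p ∪ q ∣ + ∣ p ∩ q ∣ ≡ ∣ p ∣ + ∣ q ∣
∣p∪q∣+∣p∩q∣ [] [] = refl
∣p∪q∣+∣p∩q∣ (outside ∷ p) (outside ∷ q) = ∣p∪q∣+∣p∩q∣ p q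
∣p∪q∣+∣p∩q∣ (inside  ∷ p) (outside ∷ q) = cong suc (∣p∪q∣+∣p∩q∣ p q)
∣p∪q∣+∣p∩q∣ (outside ∷ p) (inside  ∷ q) =
  trans (cong suc (∣p∪q∣+∣p∩q∣ p q)) (sym (ℕ.+-suc ∣ p ∣ ∣ q ∣))
∣p∪q∣+∣p∩q∣ (inside  ∷ p) (inside  ∷ q) =
  cong suc (trans (ℕ.+-suc ∣ p ∪ q ∣ ∣ p ∩ q ∣)
                  (trans (cong suc (∣p∪q∣+∣p∩q∣ p q)) (sym (ℕ.+-suc ∣ p ∣ ∣ q ∣))))

∣p∪q∣≤∣p∣+∣q∣ : ∀ {N} (p q : Subset N) → ∣ p ∪ q ∣ ≤ ∣ p ∣ + ∣ q ∣
∣p∪q∣≤∣p∣+∣q∣ p q = subst (∣ p ∪ q ∣ ≤_) (∣p∪q∣+∣p∩q∣ p q) (ℕ.m≤m+n ∣ p ∪ q ∣ ∣ p ∩ q ∣)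

∣p∣≤1+∣p-x∣ : ∀ {N} (p : Subset N) x → ∣ p ∣ ≤ suc ∣ p - x ∣
∣p∣≤1+∣p-x∣ p x = ℕ.≤-trans (S.p⊆q⇒∣p∣≤∣q∣ p⊆)
  (subst (λ c → ∣ ⁅ x ⁆ ∪ (p - x) ∣ ≤ c + ∣ p - x ∣) (S.∣⁅x⁆∣≡1 x) (∣p∪q∣≤∣p∣+∣q∣ ⁅ x ⁆ (p - x)))
  where
  p⊆ : p ⊆ ⁅ x ⁆ ∪ (p - x)
  p⊆ {y} y∈p with y F.≟ x
  ... | yes refl = S.x∈p∪q⁺ (inj₁ (S.x∈⁅x⁆ x))
  ... | no y≢x = S.x∈p∪q⁺ (inj₂ (S.x∈p∧x≢y⇒x∈p-y y∈p y≢x))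

x∉p-x : ∀ {N} (p : Subset N) x → x ∉ p - x
x∉p-x (outside ∷ p) zero ()
x∉p-x (inside ∷ p) zero ()
x∉p-x (_ ∷ p) (suc x) (there x∈) = x∉p-x p x x∈

∣-∣-injects : ∀ {N} h (p : Subset N) (φ : Fin N → ℕ) → (∀ {v} → v ∈ p → φ v < h) →
              (∀ {u v} → u ∈ p → v ∈ p → φ u ≡ φ v → u ≡ v) → ∣ p ∣ ≤ h
∣-∣-injects {N} h p φ bound inj with F.any? (λ v → v S.∈? p)
... | no none = subst (_≤ h) (sym (trans (cong ∣_∣ (S.Empty-unique none)) (S.∣⊥∣≡0 N))) z≤n
∣-∣-injects zero p φ bound inj | yes (v , v∈p) with () ← bound v∈p
∣-∣-injects (suc h) p φ bound inj | yes _ with F.any? (λ v → v S.∈? p ×-dec (φ v ≟ h))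
... | no none = ℕ.m≤n⇒m≤1+n (∣-∣-injects h p φ
        (λ v∈p → ℕ.≤∧≢⇒< (ℕ.≤-pred (bound v∈p)) λ φv≡h → none (_ , v∈p , φv≡h)) inj)
... | yes (v , v∈p , φv≡h) = ℕ.≤-trans (∣p∣≤1+∣p-x∣ p v) (s≤s (∣-∣-injects h (p - v) φ
        (λ {u} u∈ → ℕ.≤∧≢⇒< (ℕ.≤-pred (bound (S.p─q⊆p p ⁅ v ⁆ u∈)))
                 λ φu≡h → x∉p-x p v (subst (_∈ p - v) (inj (S.p─q⊆p p ⁅ v ⁆ u∈) v∈p (trans φu≡h (sym φv≡h))) u∈))
        λ u∈ w∈ → inj (S.p─q⊆p p ⁅ v ⁆ u∈) (S.p─q⊆p p ⁅ v ⁆ w∈)))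

-- Rainbow connections and their lifting along a contraction

module _ {L : Set} (R : L → L → Set) (γ : L → L → ℕ) (k : ℕ) (pick : ℕ → L × L) where

  Picked : L → L → Set
  Picked u v = R u v × γ u v < k × (pick (γ u v) ≡ (u , v) ⊎ pick (γ u v) ≡ (v , u))

-- The edges of a rainbow tree are described by choosing, for each colour c below k,
-- a single edge pick c; colours of γ that are at least k are never used.
record Rainbow₃ {L : Set} (U : L → Set) (R : L → L → Set) (k : ℕ) : Set where
  field
    γ     : L → L → ℕ
    γ-sym : ∀ u v → γ u v ≡ γ v u
    join  : (s : Fin 3 → L) → (∀ i → U (s i)) →
            Σ[ pick ∈ (ℕ → L × L) ] (∀ i j → Star (Picked R γ k pick) (s i) (s j))

module _ {L : Set} (R : L → L → Set) (R-sym : ∀ {u v} → R u v → R v u)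
         (γ : L → L → ℕ) (γ-sym : ∀ u v → γ u v ≡ γ v u) (k : ℕ) (pick : ℕ → L × L) where

  picked-sym : ∀ {u v} → Picked R γ k pick u v → Picked R γ k pick v u
  picked-sym {u} {v} (r , <k , eq) rewrite γ-sym u v = R-sym r , <k , [ inj₂ , inj₁ ]′ eq

-- `μ` contracts `R′` onto `R`. An edge between different fibres inherits the colour of its image,
-- and one representative of each picked edge is picked above it. Edges inside fibres are coloured
-- by `γ∞`; the ones used have colours from `k` up to `k′`, so they never clash with inherited
-- colours. A walk is lifted edge by edge, and its gaps are bridged inside the fibres.
module Lift
  {L L′ : Set} {U : L → Set} {U′ : L′ → Set} {R : L → L → Set} {R′ : L′ → L′ → Set}
  (_≟ᴸ_ : DecidableEquality L) (R? : ∀ i j → Dec (R i j))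
  (R-irrefl : ∀ {i} → ¬ R i i) (R-sym : ∀ {i j} → R i j → R j i) (R′-sym : ∀ {u v} → R′ u v → R′ v u)
  (μ : L′ → L) (μ-U : ∀ {u} → U′ u → U (μ u))
  (realise : ∀ {i j} → R i j → ∃[ u ] ∃[ v ] (U′ u × U′ v × R′ u v × μ u ≡ i × μ v ≡ j))
  {k k′ : ℕ} (k≤k′ : k ≤ k′)
  (γ∞ : L′ → L′ → ℕ) (γ∞-sym : ∀ u v → γ∞ u v ≡ γ∞ v u) (pick∞ : ℕ → L′ × L′)
  where

  Contracted : L′ → L′ → Set
  Contracted u v = μ u ≡ μ v × k ≤ γ∞ u v × Picked R′ γ∞ k′ pick∞ u v

  module _ (fibre : ∀ {u v} → U′ u → U′ v → μ u ≡ μ v → Star Contracted u v)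
           (rb : Rainbow₃ U R k) where

    open Rainbow₃ rb

    γ′ : L′ → L′ → ℕ
    γ′ u v = if does (μ u ≟ᴸ μ v) then γ∞ u v else γ (μ u) (μ v)

    γ′-same : ∀ {u v} → μ u ≡ μ v → γ′ u v ≡ γ∞ u v
    γ′-same {u} {v} eq with μ u ≟ᴸ μ v
    ... | yes _ = refl
    ... | no ≢ = contradiction eq ≢

    γ′-diff : ∀ {u v} → μ u ≢ μ v → γ′ u v ≡ γ (μ u) (μ v)
    γ′-diff {u} {v} ≢ with μ u ≟ᴸ μ v
    ... | yes eq = contradiction eq ≢
    ... | no _ = refl

    γ′-sym : ∀ u v → γ′ u v ≡ γ′ v u
    γ′-sym u v with μ u ≟ᴸ μ v
    ... | yes eq = trans (γ∞-sym u v) (sym (γ′-same (sym eq)))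
    ... | no ≢ = trans (γ-sym (μ u) (μ v)) (sym (γ′-diff (≢ ∘ sym)))

    module _ (pick : ℕ → L × L) where

      edge : L × L → L′ × L′
      edge (i , j) with R? i j
      ... | yes r = let (u , v , _) = realise r in u , v
      -- Any pair would do: the value of `edge` matters only at edges of `R`.
      ... | no _ = pick∞ 0

      pick′ : ℕ → L′ × L′
      pick′ c with c <? k
      ... | yes _ = edge (pick c)
      ... | no _ = pick∞ c

      pick′-< : ∀ {c} → c < k → pick′ c ≡ edge (pick c)
      pick′-< {c} c<k with c <? k
      ... | yes _ = refl
      ... | no c≮k = contradiction c<k c≮k

      pick′-≥ : ∀ {c} → k ≤ c → pick′ c ≡ pick∞ c
      pick′-≥ {c} k≤c with c <? k
      ... | yes c<k = contradiction c<k (ℕ.≤⇒≯ k≤c)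
      ... | no _ = refl

      within : ∀ {u v} → Contracted u v → Picked R′ γ′ k′ pick′ u v
      within (eq , k≤ , r , <k′ , p) rewrite γ′-same eq | pick′-≥ k≤ = r , <k′ , p

      edge-realises : ∀ {i j} → R i j → ∃[ u ] ∃[ v ] (edge (i , j) ≡ (u , v) × U′ u × U′ v × R′ u v × μ u ≡ i × μ v ≡ j)
      edge-realises {i} {j} r with R? i j
      ... | yes r′ = let (u , v , rest) = realise r′ in u , v , refl , rest
      ... | no ¬r = contradiction r ¬r

      across : ∀ {i j} → Picked R γ k pick i j →
               ∃[ u ] ∃[ v ] (U′ u × U′ v × Picked R′ γ′ k′ pick′ u v × μ u ≡ i × μ v ≡ j)
      across {i} {j} (r , <k , inj₁ p) with edge-realises r
      ... | u , v , eq , Uu , Uv , r′ , refl , refl =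
        u , v , Uu , Uv , (r′ , subst (_< k′) (sym γ≡) (ℕ.<-≤-trans <k k≤k′) ,
          inj₁ (trans (cong pick′ γ≡) (trans (pick′-< <k) (trans (cong edge p) eq)))) , refl , refl
        where γ≡ = γ′-diff {u} {v} λ e → R-irrefl (subst (λ z → R z (μ v)) e r)
      across {i} {j} (r , <k , inj₂ p) with edge-realises (R-sym r)
      ... | v , u , eq , Uv , Uu , r′ , refl , refl =
        u , v , Uu , Uv , (R′-sym r′ , subst (_< k′) (sym γ≡) (ℕ.<-≤-trans <k k≤k′) ,
          inj₂ (trans (cong pick′ γ≡) (trans (pick′-< <k) (trans (cong edge p) eq)))) , refl , refl
        where γ≡ = γ′-diff {u} {v} λ e → R-irrefl (subst (λ z → R z (μ v)) e r)

      walk : ∀ {i j} → Star (Picked R γ k pick) i j → ∀ {u v} → U′ u → U′ v → μ u ≡ i → μ v ≡ j →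
             Star (Picked R′ γ′ k′ pick′) u v
      walk ε Uu Uv refl eq = Star.map within (fibre Uu Uv (sym eq))
      walk (p ◅ ps) Uu Uv refl eq with across p
      ... | x , y , Ux , Uy , q , μx , μy =
        Star.map within (fibre Uu Ux (sym μx)) ◅◅ q ◅ walk ps Uy Uv μy eq

    lift : Rainbow₃ U′ R′ k′
    lift = record
      { γ = γ′ ; γ-sym = γ′-sym
      ; join = λ s Us → let (pick , conn) = join (μ ∘ s) (μ-U ∘ Us) in
          pick′ pick , λ i j → walk pick (conn i j) (Us i) (Us j) refl refl }

-- The saving is measured against one colour per vertex. A spanning tree gives `d = 1`, so blocks in
-- 𝒞 are to reach 2 and blocks in 𝒟 are to reach 3.
record Deficient {N} (G : Graph N) (d : ℕ) : Set where
  constructor deficient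
  field
    {colours} : ℕ
    rainbow₃  : Rainbow₃ (_∈ V G) (Adj G) colours
    bound     : colours + d ≤ order G

-- Contractions

module _ {N : ℕ} (G : Graph N) where

  adj-V′ : ∀ {u v} → Adj G u v → v ∈ V G
  adj-V′ e = adj-V G (adj-sym G e)

  NoCut : Set
  NoCut = ∀ x {u v} → u ∈ V G → v ∈ V G → u ≢ x → v ≢ x → Star (AdjAvoiding G x) u v

  -- The condition `i ≢ j` discards edges inside a fibre; parallel edges merge because only
  -- existence is recorded.
  Quotient : (Fin N → ℕ) → ℕ → ℕ → Set
  Quotient φ i j = i ≢ j × ∃[ u ] ∃[ v ] (Adj G u v × φ u ≡ i × φ v ≡ j)

  quotient? : ∀ φ i j → Dec (Quotient φ i j)
  quotient? φ i j = ¬? (i ≟ j) ×-dec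
    F.any? λ u → F.any? λ v → T? (adj G u v) ×-dec (φ u ≟ i ×-dec φ v ≟ j)

  quotient-sym : ∀ {φ i j} → Quotient φ i j → Quotient φ j i
  quotient-sym (i≢j , u , v , e , φu , φv) = i≢j ∘ sym , v , u , adj-sym G e , φv , φu

  -- A contraction of G onto a graph with vertex set {0, …, h − 1}.
  record Contraction (h : ℕ) : Set where
    field
      φ      : Fin N → ℕ
      φ<h    : ∀ {v} → v ∈ V G → φ v < h
      φ-surj : ∀ {i} → i < h → ∃[ v ] (v ∈ V G × φ v ≡ i)
      fibre  : ∀ {u v} → u ∈ V G → v ∈ V G → φ u ≡ φ v → Star (λ x y → Adj G x y × φ x ≡ φ y) u v

    h≤order : h ≤ order G
    h≤order = ∣-∣-covers h (V G) φ φ-surj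

    Collision : Set
    Collision = ∃[ u ] ∃[ v ] (u ∈ V G × v ∈ V G × u ≢ v × φ u ≡ φ v)

    collision? : Dec Collision
    collision? = F.any? λ u → F.any? λ v →
      u S.∈? V G ×-dec (v S.∈? V G ×-dec (¬? (u F.≟ v) ×-dec φ u ≟ φ v))

    no-collision⇒injective : ¬ Collision → ∀ {u v} → u ∈ V G → v ∈ V G → φ u ≡ φ v → u ≡ v
    no-collision⇒injective none {u} {v} u∈ v∈ eq with u F.≟ v
    ... | yes u≡v = u≡v
    ... | no u≢v = contradiction (u , v , u∈ , v∈ , u≢v , eq) none

  -- The fibre of w is cut into two connected parts, which get the labels w and h.
  record Split {h} (M : Contraction h) (w : ℕ) (a b : Fin N) : Set where
    private module M = Contraction M
    field
      M′     : Contraction (suc h)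
    open Contraction M′
    field
      w<h    : w < h
      refine : ∀ v → φ v ≡ M.φ v ⊎ M.φ v ≡ w × φ v ≡ h
      φa≡w   : φ a ≡ w
      φb≡h   : φ b ≡ h
      w~h    : Quotient φ w h

    away : ∀ {v} → M.φ v ≢ w → φ v ≡ M.φ v
    away {v} ≢w with refine v
    ... | inj₁ eq = eq
    ... | inj₂ (≡w , _) = contradiction ≡w ≢w

    keep : ∀ {i j} → i ≢ w → j ≢ w → Quotient M.φ i j → Quotient φ i j
    keep i≢w j≢w (i≢j , u , v , e , refl , refl) = i≢j , u , v , e , away i≢w , away j≢w

    share : ∀ {j} → j < h → Quotient M.φ w j → Quotient φ w j ⊎ Quotient φ h j
    share j<h (w≢j , u , v , e , φu≡w , refl) with refine u
    ... | inj₁ eq = inj₁ (w≢j , u , v , e , trans eq φu≡w , away (w≢j ∘ sym))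
    ... | inj₂ (_ , eq) = inj₂ (ℕ.<⇒≢ j<h ∘ sym , u , v , e , eq , away (w≢j ∘ sym))

    forget : ∀ {i j} → i ≢ w → i ≢ h → j ≢ w → j ≢ h → Quotient φ i j → Quotient M.φ i j
    forget i≢w i≢h j≢w j≢h (i≢j , u , v , e , refl , refl) with refine u | refine v
    ... | inj₂ (_ , eq) | _ = contradiction eq i≢h
    ... | inj₁ _ | inj₂ (_ , eq) = contradiction eq j≢h
    ... | inj₁ p | inj₁ q = i≢j , u , v , e , sym p , sym q

    forget-w : ∀ {i j} → i ≡ w ⊎ i ≡ h → j ≢ w → j ≢ h → Quotient φ i j → Quotient M.φ w j
    forget-w i≡ j≢w j≢h (i≢j , u , v , e , refl , refl) with refine u | refine v
    ... | _ | inj₂ (_ , eq) = contradiction eq j≢h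
    ... | inj₂ (p , _) | inj₁ q = j≢w ∘ sym , u , v , e , p , sym q
    ... | inj₁ p | inj₁ q = j≢w ∘ sym , u , v , e , [ trans (sym p) , (λ φu≡h →
            contradiction (trans (sym p) φu≡h) (ℕ.<⇒≢ (M.φ<h (adj-V G e)))) ]′ i≡ , sym q

  -- The near part is what `a` reaches inside the fibre without meeting `b`; the rest of the fibre
  -- goes with `b`. The rest is connected too: a walk in the fibre from a far vertex to `b` cannot
  -- enter the near part before it meets `b`, since the step back would make the far vertex near.
  module _ {h} (M : Contraction h) {a b} (a∈ : a ∈ V G) (b∈ : b ∈ V G) (a≢b : a ≢ b)
           (φa≡φb : Contraction.φ M a ≡ Contraction.φ M b) where

    open Contraction M

    private
      w = φ a

      Step : Fin N → Fin N → Set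
      Step x y = Adj G x y × φ x ≡ φ y × x ≢ b × y ≢ b

      Near : Fin N → Set
      Near = Star Step a

      near? : ∀ v → Dec (Near v)
      near? = star? (λ x y → T? (adj G x y) ×-dec (φ x ≟ φ y ×-dec (¬? (x F.≟ b) ×-dec ¬? (y F.≟ b)))) a

      near⇒w : ∀ {x v} → Star Step x v → φ v ≡ φ x
      near⇒w ε = refl
      near⇒w ((_ , eq , _) ◅ ps) = trans (near⇒w ps) (sym eq)

      avoids : ∀ {x v} → x ≢ b → Star Step x v → v ≢ b
      avoids x≢b ε = x≢b
      avoids x≢b ((_ , _ , _ , y≢b) ◅ ps) = avoids y≢b ps

      ψ : Fin N → ℕ
      ψ v with φ v ≟ w | near? v
      ... | yes _ | no _ = h
      ... | _ | _ = φ v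

      ψ-near : ∀ {v} → Near v → ψ v ≡ w
      ψ-near {v} n with φ v ≟ w | near? v
      ... | yes _ | no ¬n = contradiction n ¬n
      ... | yes eq | yes _ = eq
      ... | no ≢w | _ = contradiction (near⇒w n) ≢w

      ψ-far : ∀ {v} → φ v ≡ w → ¬ Near v → ψ v ≡ h
      ψ-far {v} eq ¬n with φ v ≟ w | near? v
      ... | yes _ | no _ = refl
      ... | yes _ | yes n = contradiction n ¬n
      ... | no ≢w | _ = contradiction eq ≢w

      ψ-away : ∀ {v} → φ v ≢ w → ψ v ≡ φ v
      ψ-away {v} ≢w with φ v ≟ w | near? v
      ... | yes eq | _ = contradiction eq ≢w
      ... | no _ | yes _ = refl
      ... | no _ | no _ = refl

      InFibre : Fin N → Fin N → Set
      InFibre x y = Adj G x y × ψ x ≡ ψ y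

      walk-away : ∀ {x y} → φ x ≢ w → Star (λ x y → Adj G x y × φ x ≡ φ y) x y → Star InFibre x y
      walk-away ≢w ε = ε
      walk-away ≢w ((e , eq) ◅ ps) =
        (e , trans (ψ-away ≢w) (trans eq (sym (ψ-away (≢w ∘ trans eq))))) ◅ walk-away (≢w ∘ trans eq) ps

      walk-near : ∀ {x y} → Near x → Star Step x y → Star InFibre x y
      walk-near n ε = ε
      walk-near n (p ◅ ps) = (proj₁ p , trans (ψ-near n) (sym (ψ-near n′))) ◅ walk-near n′ ps
        where n′ = n ◅◅ p ◅ ε

      b-far : ¬ Near b
      b-far n = avoids a≢b n refl

      ψb≡h : ψ b ≡ h
      ψb≡h = ψ-far (sym φa≡φb) b-far

      walk-far : ∀ {x} → φ x ≡ w → ¬ Near x → Star (λ x y → Adj G x y × φ x ≡ φ y) x b → Star InFibre x b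
      walk-far ≡w ¬n ε = ε
      walk-far {x} ≡w ¬n (_◅_ {_} {y} (e , eq) ps) with x F.≟ b | y F.≟ b
      ... | yes refl | _ = ε
      ... | no _ | yes refl = (e , trans (ψ-far ≡w ¬n) (sym ψb≡h)) ◅ ε
      ... | no x≢b | no y≢b =
        (e , trans (ψ-far ≡w ¬n) (sym (ψ-far ≡w′ ¬n′))) ◅ walk-far ≡w′ ¬n′ ps
        where
        ≡w′ = trans (sym eq) ≡w
        ¬n′ = λ n → ¬n (n ◅◅ (adj-sym G e , sym eq , y≢b , x≢b) ◅ ε)

      data Part (v : Fin N) : Set where
        near : Near v → ψ v ≡ w → Part v
        far  : φ v ≡ w → ¬ Near v → ψ v ≡ h → Part v
        away : φ v ≢ w → ψ v ≡ φ v → Part v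

      part : ∀ v → Part v
      part v with φ v ≟ w | near? v
      ... | no ≢w | _ = away ≢w (ψ-away ≢w)
      ... | yes _ | yes n = near n (ψ-near n)
      ... | yes eq | no ¬n = far eq ¬n (ψ-far eq ¬n)

      φ<h′ : w < h
      φ<h′ = φ<h a∈

      ψ-fibre : ∀ {u v} → u ∈ V G → v ∈ V G → ψ u ≡ ψ v → Star InFibre u v
      ψ-fibre {u} {v} u∈ v∈ eq with part u | part v
      ... | near n _ | near n′ _ =
        reverse (λ (e , eq) → adj-sym G e , sym eq) (walk-near ε n) ◅◅ walk-near ε n′
      ... | far p ¬n _ | far p′ ¬n′ _ =
        walk-far p ¬n (fibre u∈ b∈ (trans p φa≡φb)) ◅◅
        reverse (λ (e , eq) → adj-sym G e , sym eq) (walk-far p′ ¬n′ (fibre v∈ b∈ (trans p′ φa≡φb)))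
      ... | away ≢w q | away _ q′ = walk-away ≢w (fibre u∈ v∈ (trans (sym q) (trans eq q′)))
      ... | near _ q | far _ _ q′ = contradiction (trans (sym q) (trans eq q′)) (ℕ.<⇒≢ φ<h′)
      ... | far _ _ q | near _ q′ = contradiction (trans (sym q′) (trans (sym eq) q)) (ℕ.<⇒≢ φ<h′)
      ... | near _ q | away ≢w q′ = contradiction (trans (sym q′) (trans (sym eq) q)) ≢w
      ... | away ≢w q | near _ q′ = contradiction (trans (sym q) (trans eq q′)) ≢w
      ... | far _ _ q | away _ q′ = contradiction (trans (sym q′) (trans (sym eq) q)) (ℕ.<⇒≢ (φ<h v∈))
      ... | away _ q | far _ _ q′ = contradiction (trans (sym q) (trans eq q′)) (ℕ.<⇒≢ (φ<h u∈))

      ψ-surj : ∀ {i} → i < suc h → ∃[ v ] (v ∈ V G × ψ v ≡ i)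
      ψ-surj {i} i<1+h with i ≟ h | i ≟ w
      ... | yes refl | _ = b , b∈ , ψb≡h
      ... | no _ | yes refl = a , a∈ , ψ-near ε
      ... | no i≢h | no i≢w with φ-surj (ℕ.≤∧≢⇒< (ℕ.≤-pred i<1+h) i≢h)
      ...   | v , v∈ , refl = v , v∈ , ψ-away i≢w

      ψ<1+h : ∀ {v} → v ∈ V G → ψ v < suc h
      ψ<1+h {v} v∈ with part v
      ... | near _ q = subst (_< suc h) (sym q) (ℕ.m<n⇒m<1+n φ<h′)
      ... | far _ _ q = subst (_< suc h) (sym q) (ℕ.n<1+n h)
      ... | away _ q = subst (_< suc h) (sym q) (ℕ.m<n⇒m<1+n (φ<h v∈))

      ψ-refine : ∀ v → ψ v ≡ φ v ⊎ φ v ≡ w × ψ v ≡ h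
      ψ-refine v with part v
      ... | near n q = inj₁ (trans q (sym (near⇒w n)))
      ... | far p _ q = inj₂ (p , q)
      ... | away _ q = inj₁ q

      ψ-w~h : Quotient ψ w h
      ψ-w~h with crossing {P = λ v → φ v ≡ w × Near v} (λ v → φ v ≟ w ×-dec near? v)
                   (fibre a∈ b∈ φa≡φb) (refl , ε) (b-far ∘ proj₂)
      ... | x , y , (e , eq) , (≡w , n) , ¬p =
        ℕ.<⇒≢ φ<h′ , x , y , e , ψ-near n , ψ-far ≡w′ (λ n′ → ¬p (≡w′ , n′))
        where ≡w′ = trans (sym eq) ≡w

    split : Split M w a b
    split = record
      { M′ = record { φ = ψ ; φ<h = ψ<1+h ; φ-surj = ψ-surj ; fibre = ψ-fibre }
      ; w<h = φ<h′ ; refine = ψ-refine ; φa≡w = ψ-near ε ; φb≡h = ψb≡h ; w~h = ψ-w~h }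

module _ {N : ℕ} {G : Graph N} where

  module _ {h} {M : Contraction G h} {w a b} (sp : Split G M w a b) where

    private
      module M = Contraction M
    open Split sp
    open Contraction M′

    private
      merge : ℕ → ℕ
      merge i with i ≟ h
      ... | yes _ = w
      ... | no _ = i

      merge-h : merge h ≡ w
      merge-h with h ≟ h
      ... | yes _ = refl
      ... | no h≢h = contradiction refl h≢h

      merge-< : ∀ {i} → i ≢ h → merge i ≡ i
      merge-< {i} i≢h with i ≟ h
      ... | yes eq = contradiction eq i≢h
      ... | no _ = refl

      merge-φ : ∀ {v} → v ∈ V G → merge (φ v) ≡ M.φ v
      merge-φ {v} v∈ with refine v
      ... | inj₁ eq = trans (cong merge eq) (merge-< (ℕ.<⇒≢ (M.φ<h v∈)))
      ... | inj₂ (eq , eq′) = trans (cong merge eq′) (trans merge-h (sym eq))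

      merge-bound : ∀ {i} → i < suc h → merge i < h
      merge-bound {i} i<1+h with i ≟ h
      ... | yes _ = w<h
      ... | no i≢h = ℕ.≤∧≢⇒< (ℕ.≤-pred i<1+h) i≢h

      realise : ∀ {i j} → Quotient G M.φ i j →
                ∃[ u ] ∃[ v ] (u < suc h × v < suc h × Quotient G φ u v × merge u ≡ i × merge v ≡ j)
      realise (i≢j , u , v , e , refl , refl) =
        φ u , φ v , φ<h u∈ , φ<h v∈ ,
        ((λ eq → i≢j (trans (sym (merge-φ u∈)) (trans (cong merge eq) (merge-φ v∈)))) , u , v , e , refl , refl) ,
        merge-φ u∈ , merge-φ v∈
        where
        u∈ = adj-V G e
        v∈ = adj-V′ G e

    -- Only `w` and `h` are merged, so the edge between them is the one that needs the new colour
    -- `k`, and the pick for that colour is the constant pair `(w , h)`.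
    rainbow₃-split : ∀ {k} → Rainbow₃ (_< h) (Quotient G M.φ) k → Rainbow₃ (_< suc h) (Quotient G φ) (suc k)
    rainbow₃-split {k} = lift λ {u} {v} → fibre′ {u} {v}
      where
      open Lift {U = _< h} {U′ = _< suc h} _≟_ (quotient? G M.φ) (λ (i≢i , _) → i≢i refl) (quotient-sym G) (quotient-sym G)
                merge merge-bound realise (ℕ.n≤1+n k) (λ _ _ → k) (λ _ _ → refl) (λ _ → w , h)

      w-to-h : Contracted w h
      w-to-h = trans (merge-< (ℕ.<⇒≢ w<h)) (sym merge-h) , ℕ.≤-refl , w~h , ℕ.n<1+n k , inj₁ refl

      h-to-w : Contracted h w
      h-to-w = sym (proj₁ w-to-h) , ℕ.≤-refl , quotient-sym G w~h , ℕ.n<1+n k , inj₂ refl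

      fibre′ : ∀ {u v} → u < suc h → v < suc h → merge u ≡ merge v → Star Contracted u v
      fibre′ {u} {v} _ _ eq with u ≟ h | v ≟ h
      ... | yes refl | yes refl = ε
      ... | yes refl | no _ = subst (Star Contracted h) eq (h-to-w ◅ ε)
      ... | no _ | yes refl = subst (λ x → Star Contracted x h) (sym eq) (w-to-h ◅ ε)
      ... | no _ | no _ = subst (Star Contracted u) eq ε

  injective⇒rainbow₃ : ∀ {h k} (M : Contraction G h) → 1 ≤ h → ¬ Contraction.Collision M →
                       Rainbow₃ (_< h) (Quotient G (Contraction.φ M)) k → Rainbow₃ (_∈ V G) (Adj G) k
  injective⇒rainbow₃ {h} {k} M 1≤h none rb = lift (λ {u} {v} → fibre′ {u} {v}) rb
    where
    open Contraction M
    -- A vertex to build the default pair from; with singleton fibres no new colour is picked.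
    v₀ = proj₁ (φ-surj 1≤h)
    open Lift {U = _< h} {U′ = _∈ V G} _≟_ (quotient? G φ) (λ (i≢i , _) → i≢i refl) (quotient-sym G) (adj-sym G)
              φ φ<h (λ (_ , u , v , e , p , q) → u , v , adj-V G e , adj-V′ G e , e , p , q)
              (ℕ.≤-refl {k}) (λ _ _ → 0) (λ _ _ → refl) (λ _ → v₀ , v₀)

    fibre′ : ∀ {u v} → u ∈ V G → v ∈ V G → φ u ≡ φ v → Star Contracted u v
    fibre′ u∈ v∈ eq = subst (Star Contracted _) (no-collision⇒injective none u∈ v∈ eq) ε

  -- Every split adds one vertex and one colour, so `k + d ≤ h` persists until all fibres are single
  -- vertices. The fuel `t` bounds the number of splits still possible.
  expand : ∀ {d} t {h k} (M : Contraction G h) → order G ≤ h + t →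
           Rainbow₃ (_< h) (Quotient G (Contraction.φ M)) k → k + d ≤ h → 1 ≤ h → Deficient G d
  expand t {h} M n≤h+t rb k+d≤h 1≤h with Contraction.collision? M
  ... | no none = deficient (injective⇒rainbow₃ M 1≤h none rb) (ℕ.≤-trans k+d≤h (Contraction.h≤order M))
  ... | yes (_ , _ , a∈ , b∈ , a≢b , eq) with split G M a∈ b∈ a≢b eq
  ...   | sp = next t n≤h+t
    where
    next : ∀ t → order G ≤ h + t → Deficient G _
    next zero n≤h = contradiction (ℕ.≤-trans (Contraction.h≤order (Split.M′ sp)) (subst (order G ≤_) (ℕ.+-identityʳ h) n≤h)) ℕ.1+n≰n
    next (suc t) n≤ = expand t (Split.M′ sp) (subst (order G ≤_) (ℕ.+-suc h t) n≤) (rainbow₃-split sp rb) (s≤s k+d≤h) (ℕ.m≤n⇒m≤1+n 1≤h)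

-- Finite verification

Edges : Set
Edges = List (ℕ × ℕ)

_≐_ : ℕ × ℕ → ℕ × ℕ → Bool
(i , j) ≐ (x , y) = (i ≡ᵇ x) ∧ (j ≡ᵇ y)

nth : List ℕ → ℕ → ℕ
nth [] _ = 0
nth (x ∷ xs) zero = x
nth (x ∷ xs) (suc n) = nth xs n

index : ℕ → List ℕ → ℕ
index y [] = 0
index y (x ∷ xs) = if x ≡ᵇ y then 0 else suc (index y xs)

joined : Edges → ℕ → ℕ → Bool
joined es i j = any (λ e → (e ≐ (i , j)) ∨ (e ≐ (j , i))) es

neighbours : Edges → ℕ → List ℕ
neighbours [] v = []
neighbours ((i , j) ∷ es) v =
  if i ≡ᵇ v then j ∷ neighbours es v else if j ≡ᵇ v then i ∷ neighbours es v else neighbours es v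

_∈ᵇ_ : ℕ → List ℕ → Bool
x ∈ᵇ ys = any (_≡ᵇ x) ys

row : List (List ℕ) → ℕ → List ℕ
row [] _ = []
row (r ∷ rs) zero = r
row (r ∷ rs) (suc n) = row rs n

-- Images are collected in reverse order. A vertex with an earlier neighbour is tried only at the
-- neighbours of that neighbour's image, and too small degrees are pruned. The lists produced are
-- mere proposals; soundness rests on `isCopy`, which checks each of them again.
place : ℕ → List (List ℕ) → List (ℕ × List ℕ) → List ℕ → List (List ℕ)
extend : ℕ → List (List ℕ) → ℕ → List ℕ → List (ℕ × List ℕ) → List ℕ → List ℕ → List (List ℕ)
place h adjacent [] f = List.reverse f ∷ []
place h adjacent ((d , []) ∷ ps) f = extend h adjacent d [] ps f (upTo h)
place h adjacent ((d , i ∷ is) ∷ ps) f = extend h adjacent d is ps f (row adjacent (nth f i))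

extend h adjacent d is ps f [] = []
extend h adjacent d is ps f (c ∷ cs) =
  if (d <ᵇ suc (length (row adjacent c))) ∧ (not (c ∈ᵇ f) ∧ all (λ i → nth f i ∈ᵇ row adjacent c) is)
  then place h adjacent ps (c ∷ f) ++ extend h adjacent d is ps f cs
  else extend h adjacent d is ps f cs

-- When `i` is about to be placed, the image of an earlier vertex `j` stands at position i - j - 1
-- of the reversed list of images.
profile : Edges → ℕ → ℕ × List ℕ
profile t i = length (neighbours t i) , map (λ j → (i ∸ j) ∸ 1) (filter (_<? i) (neighbours t i))

-- Backtracking search for copies of the graph t in es, each listed as the images of 0, 1, ….
copies : ℕ → Edges → Edges → List (List ℕ)
copies h t es = place h (map (neighbours es) (upTo h)) (map (profile t) (upTo h)) []

-- The second conjunct demands a permutation of 0, ..., h - 1 with inverse `index`, because a copy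
-- is later used to relabel a contraction.
isCopy : ℕ → Edges → Edges → List ℕ → Bool
isCopy h t es f =
  all (λ (i , j) → (i <ᵇ h) ∧ ((j <ᵇ h) ∧ joined es (nth f i) (nth f j))) t ∧
  all (λ i → (nth f i <ᵇ h) ∧ ((index i f <ᵇ h) ∧ ((index (nth f i) f ≡ᵇ i) ∧ (nth f (index i f) ≡ᵇ i)))) (upTo h)

hasCopy : ℕ → List Edges → Edges → Bool
hasCopy h ts es = any (λ t → any (isCopy h t es) (copies h t es)) ts

-- Does every graph with the edges es that meets all the clauses contain a copy of some t in ts?
unavoidable : ℕ → List Edges → Edges → List Edges → Bool
unavoidable h ts es [] = hasCopy h ts es
unavoidable h ts es (cl ∷ cls) =
  -- A clause met by an edge already listed is dropped; otherwise there is one branch for each edge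
  -- that could meet it.
  if any (λ (i , j) → joined es i j) cl
  then unavoidable h ts es cls
  else all (λ e → unavoidable h ts (e ∷ es) cls) cl

avoiding : ℕ → ℕ → List ℕ
avoiding w h = filter (λ x → ¬? (x ≟ w)) (upTo h)

splitEdges : ℕ → ℕ → Edges → Edges
splitEdges w h t = (w , h) ∷ filter (λ (i , j) → ¬? (i ≟ w) ×-dec ¬? (j ≟ w)) t

-- Each edge at w is passed on to w or h, and both w and h have neighbours outside {w, h}.
splitClauses : ℕ → ℕ → Edges → List Edges
splitClauses w h t = concatMap sides t ++ map (w ,_) (avoiding w h) ∷ map (h ,_) (avoiding w h) ∷ []
  where
  sides : ℕ × ℕ → List Edges
  sides (i , j) = if i ≡ᵇ w then ((w , j) ∷ (h , j) ∷ []) ∷ [] else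
                  if j ≡ᵇ w then ((w , i) ∷ (h , i) ∷ []) ∷ [] else []

splits : ℕ → List Edges → List Edges → Bool
splits h ts ts′ = all (λ t → all (λ w → unavoidable (suc h) ts′ (splitEdges w h t) (splitClauses w h t)) (upTo h)) ts

cycle : ℕ → Edges
cycle zero = []
cycle (suc m) = (0 , m) ∷ map (λ i → i , suc i) (upTo m)

-- Most are theta graphs, two hubs joined by three disjoint paths. The path lengths are (1,2,2) at
-- order 4; (1,2,3) and (2,2,2) at order 5; (1,2,4), (1,3,3) and (2,2,3) at order 6; (1,2,5),
-- (1,3,4), (2,2,4) and (2,3,3) at order 7. Order 6 also needs the complete bipartite graph with
-- parts 2 and 4: it arises when a part split off a hub of the (2,2,2) graph attaches otherwise only
-- to the other hub, and its cycles are too short for a theta graph of order 6. Its successors at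
-- order 7 include hubs joined by paths (2,2,2,3) and (2,2,2,2,2). The remaining graph of order 7
-- consists of two 4-cycles sharing the vertex 0, with an edge between the vertices opposite to 0.
templates₄ templates₅ templates₆ templates₇ : List Edges
templates₄ = (cycle 4 ++ (0 , 2) ∷ []) ∷ []
templates₅ = (cycle 5 ++ (0 , 2) ∷ []) ∷ (cycle 4 ++ (0 , 4) ∷ (2 , 4) ∷ []) ∷ []
templates₆ =
  (cycle 6 ++ (0 , 2) ∷ []) ∷ (cycle 6 ++ (0 , 3) ∷ []) ∷ (cycle 5 ++ (0 , 5) ∷ (2 , 5) ∷ []) ∷
  (cycle 4 ++ (0 , 4) ∷ (2 , 4) ∷ (0 , 5) ∷ (2 , 5) ∷ []) ∷ []
-- Each graph is given by its colour classes.
gadgets₇ : List (List Edges)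
gadgets₇ =
  (((0 , 1) ∷ (2 , 3) ∷ []) ∷ ((1 , 2) ∷ (5 , 6) ∷ []) ∷ ((3 , 4) ∷ (0 , 6) ∷ []) ∷ ((4 , 5) ∷ (0 , 2) ∷ []) ∷ []) ∷
  (((0 , 1) ∷ (2 , 3) ∷ []) ∷ ((1 , 2) ∷ (4 , 5) ∷ (0 , 3) ∷ []) ∷ ((3 , 4) ∷ (5 , 6) ∷ []) ∷ ((0 , 6) ∷ []) ∷ []) ∷
  (((0 , 1) ∷ (2 , 3) ∷ []) ∷ ((1 , 2) ∷ (3 , 4) ∷ (0 , 6) ∷ []) ∷ ((4 , 5) ∷ (2 , 6) ∷ []) ∷ ((0 , 5) ∷ []) ∷ []) ∷
  (((0 , 1) ∷ (2 , 3) ∷ []) ∷ ((1 , 2) ∷ (3 , 4) ∷ (0 , 6) ∷ []) ∷ ((4 , 5) ∷ (3 , 6) ∷ []) ∷ ((0 , 5) ∷ []) ∷ []) ∷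
  (((0 , 1) ∷ (2 , 3) ∷ (0 , 5) ∷ (2 , 6) ∷ []) ∷ ((1 , 2) ∷ (3 , 4) ∷ []) ∷ ((0 , 4) ∷ []) ∷ ((2 , 5) ∷ (0 , 6) ∷ []) ∷ []) ∷
  (((0 , 1) ∷ (2 , 3) ∷ []) ∷ ((1 , 2) ∷ (3 , 4) ∷ (0 , 5) ∷ (0 , 6) ∷ []) ∷ ((0 , 4) ∷ (2 , 5) ∷ []) ∷ ((3 , 6) ∷ []) ∷ []) ∷
  (((0 , 1) ∷ (2 , 3) ∷ (0 , 4) ∷ (0 , 5) ∷ (2 , 6) ∷ []) ∷ ((1 , 2) ∷ (0 , 3) ∷ []) ∷ ((2 , 4) ∷ (0 , 6) ∷ []) ∷ ((2 , 5) ∷ []) ∷ []) ∷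
  []

templates₇ = map concat gadgets₇

cycle₄ : List Edges
cycle₄ = ((0 , 1) ∷ (2 , 3) ∷ []) ∷ ((1 , 2) ∷ (0 , 3) ∷ []) ∷ []

-- An edge in none of the classes gets the number of classes, a colour out of range that is never
-- picked.
colour : List Edges → ℕ × ℕ → ℕ
colour [] e = 0
colour (es ∷ ess) e = if any (e ≐_) es then 0 else suc (colour ess e)

-- The classes list every edge with its smaller end first.
pairColour : List Edges → ℕ → ℕ → ℕ
pairColour ess i j = colour ess (i ⊓ j , i ⊔ j)

choices : List Edges → List Edges
choices [] = [] ∷ []
choices (es ∷ ess) = concatMap (λ e → map (e ∷_) (choices ess)) es

nthEdge : Edges → ℕ → ℕ × ℕ
nthEdge [] _ = 0 , 0
nthEdge (e ∷ es) zero = e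
nthEdge (e ∷ es) (suc n) = nthEdge es n

linked : ℕ → Edges → ℕ → ℕ → Bool
linked zero es i j = i ≡ᵇ j
linked (suc n) es i j = (i ≡ᵇ j) ∨
  any (λ (x , y) → ((x ≡ᵇ i) ∧ linked n es y j) ∨ ((y ≡ᵇ i) ∧ linked n es x j)) es

oneOfEach : List Edges → Edges → Bool
oneOfEach ess es = all (λ (i , j) → (pairColour ess i j <ᵇ length ess) ∧ (nthEdge es (pairColour ess i j) ≐ (i , j))) es

-- The fuel `length ess` suffices for `linked`, because a choice has that many edges and a simple
-- path cannot be longer.
spans : List Edges → ℕ → ℕ → ℕ → Edges → Bool
spans ess a b c es = linked (length ess) es a b ∧ (linked (length ess) es a c ∧ oneOfEach ess es)

rainbowColoured : ℕ → List Edges → Bool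
rainbowColoured h ess = all (λ a → all (λ b → all (λ c → any (spans ess a b c) (choices ess)) (upTo h)) (upTo h)) (upTo h)

≡true⇒T : ∀ {b} → b ≡ true → T b
≡true⇒T refl = tt

∧⁻ : ∀ {x y} → T (x ∧ y) → T x × T y
∧⁻ = Equivalence.to T-∧

∨⁻ : ∀ {x y} → T (x ∨ y) → T x ⊎ T y
∨⁻ = Equivalence.to T-∨

all≡true : ∀ {A : Set} (p : A → Bool) xs → all p xs ≡ true → All (λ x → p x ≡ true) xs
all≡true p [] _ = []
all≡true p (x ∷ xs) eq with p x in px
... | true = px ∷ all≡true p xs eq

all-upTo⁻ : ∀ (p : ℕ → Bool) n → T (all p (upTo n)) → ∀ {i} → i < n → T (p i)
all-upTo⁻ p n t i<n = All.lookup (All.all⁺ p (upTo n) t) (List∈.∈-upTo⁺ i<n)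

≐-sound : ∀ {e e′} → T (e ≐ e′) → e ≡ e′
≐-sound {i , j} {x , y} t = let (p , q) = ∧⁻ t in cong₂ _,_ (ℕ.≡ᵇ⇒≡ i x p) (ℕ.≡ᵇ⇒≡ j y q)

-- All checks are monotone in the edges, so `Q` may be any symmetric relation that contains the
-- listed ones.
module Sound (Q : ℕ → ℕ → Set) (Q-sym : ∀ {i j} → Q i j → Q j i) where

  Present : ℕ × ℕ → Set
  Present (i , j) = Q i j

  joined-sound : ∀ {es i j} → All Present es → T (joined es i j) → Q i j
  joined-sound {es} {i} {j} qs t = All.lookupWith
    (λ {e} q t → [ (λ p → subst Present (≐-sound {e} p) q) , (λ p → Q-sym (subst Present (≐-sound {e} p) q)) ]′ (∨⁻ t))
    qs (Any.any⁻ _ es t)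

  record Copy (h : ℕ) (t : Edges) : Set where
    field
      f g   : ℕ → ℕ
      f<h   : ∀ {i} → i < h → f i < h
      g<h   : ∀ {i} → i < h → g i < h
      g∘f   : ∀ {i} → i < h → g (f i) ≡ i
      f∘g   : ∀ {i} → i < h → f (g i) ≡ i
      edges : All (λ (i , j) → i < h × j < h × Q (f i) (f j)) t

  isCopy-sound : ∀ {h t es} f → All Present es → T (isCopy h t es f) → Copy h t
  isCopy-sound {h} {t} {es} f qs c = record
    { f = nth f ; g = λ i → index i f
    ; f<h = λ {i} i<h → ℕ.<ᵇ⇒< (nth f i) h (proj₁ (bij i<h))
    ; g<h = λ {i} i<h → ℕ.<ᵇ⇒< (index i f) h (proj₁ (proj₂ (bij i<h)))
    ; g∘f = λ {i} i<h → ℕ.≡ᵇ⇒≡ _ i (proj₁ (proj₂ (proj₂ (bij i<h))))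
    ; f∘g = λ {i} i<h → ℕ.≡ᵇ⇒≡ _ i (proj₂ (proj₂ (proj₂ (bij i<h))))
    ; edges = All.map (λ {e} b → let (i< , b′) = ∧⁻ b ; (j< , joined) = ∧⁻ b′ in
                ℕ.<ᵇ⇒< (proj₁ e) h i< , ℕ.<ᵇ⇒< (proj₂ e) h j< , joined-sound qs joined) (All.all⁺ _ t (proj₁ (∧⁻ c))) }
    where
    bij : ∀ {i} → i < h → T (nth f i <ᵇ h) × T (index i f <ᵇ h) × T (index (nth f i) f ≡ᵇ i) × T (nth f (index i f) ≡ᵇ i)
    bij {i} i<h =
      let (p , r) = ∧⁻ (all-upTo⁻ _ h (proj₂ (∧⁻ {all _ t} c)) i<h)
          (q , s) = ∧⁻ r
          (u , v) = ∧⁻ s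
      in p , q , u , v

  unavoidable-sound : ∀ h ts es cls → T (unavoidable h ts es cls) → All Present es →
                      All (Any Present) cls → Any (Copy h) ts
  unavoidable-sound h ts es [] t qs [] =
    Any.map (λ {t} c → let (f , c′) = Any.satisfied (Any.any⁻ (isCopy h t es) (copies h t es) c) in isCopy-sound f qs c′)
            (Any.any⁻ _ ts t)
  unavoidable-sound h ts es (cl ∷ cls) t qs (q ∷ rs) with any (λ (i , j) → joined es i j) cl
  ... | true = unavoidable-sound h ts es cls t qs rs
  ... | false = All.lookupWith (λ {e} t′ q′ → unavoidable-sound h ts (e ∷ es) cls t′ (q′ ∷ qs) rs) (All.all⁺ _ cl t) q

  colour-sound : ∀ ess {e} → All Present (concat ess) → colour ess e < length ess → Present e
  colour-sound (es ∷ ess) {e} qs c< with any (e ≐_) es in eq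
  ... | true = All.lookupWith (λ q t → subst Present (sym (≐-sound t)) q) (All.++⁻ˡ es qs)
                 (Any.any⁻ _ es (subst T (sym eq) tt))
  ... | false = colour-sound ess (All.++⁻ʳ es qs) (ℕ.≤-pred c<)

  pairColour-sound : ∀ ess {i j} → All Present (concat ess) → pairColour ess i j < length ess → Q i j
  pairColour-sound ess {i} {j} qs c< with ℕ.≤-total i j
  ... | inj₁ i≤j = subst₂ Q (ℕ.m≤n⇒m⊓n≡m i≤j) (ℕ.m≤n⇒m⊔n≡n i≤j) (colour-sound ess qs c<)
  ... | inj₂ j≤i = Q-sym (subst₂ Q (ℕ.m≥n⇒m⊓n≡n j≤i) (ℕ.m≥n⇒m⊔n≡m j≤i) (colour-sound ess qs c<))

  module _ (ess : List Edges) (qs : All Present (concat ess)) (es : Edges) (ok : T (oneOfEach ess es)) where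

    private
      Chosen : ℕ → ℕ → Set
      Chosen = Picked Q (pairColour ess) (length ess) (nthEdge es)

      pairColour-sym : ∀ i j → pairColour ess i j ≡ pairColour ess j i
      pairColour-sym i j = cong₂ (λ x y → colour ess (x , y)) (ℕ.⊓-comm i j) (ℕ.⊔-comm i j)

    chosen : All (λ (i , j) → Chosen i j) es
    chosen = All.map (λ {(i , j)} t → let (c< , eq) = ∧⁻ t ; c<k = ℕ.<ᵇ⇒< _ _ c< in
                        pairColour-sound ess qs c<k , c<k , inj₁ (≐-sound eq)) (All.all⁺ _ es ok)

    chosen-sym : ∀ {i j} → Chosen i j → Chosen j i
    chosen-sym = picked-sym Q Q-sym (pairColour ess) pairColour-sym (length ess) (nthEdge es)

    linked-sound : ∀ n {i j} → T (linked n es i j) → Star Chosen i j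
    linked-sound zero {i} {j} t = subst (Star Chosen i) (ℕ.≡ᵇ⇒≡ i j t) ε
    linked-sound (suc n) {i} {j} t with ∨⁻ {i ≡ᵇ j} t
    ... | inj₁ eq = subst (Star Chosen i) (ℕ.≡ᵇ⇒≡ i j eq) ε
    ... | inj₂ some = All.lookupWith (λ {(x , y)} c t → [
            (λ t → let (eq , l) = ∧⁻ {x ≡ᵇ i} t in subst (λ x → Chosen x y) (ℕ.≡ᵇ⇒≡ x i eq) c ◅ linked-sound n l) ,
            (λ t → let (eq , l) = ∧⁻ {y ≡ᵇ i} t in subst (λ y → Chosen y x) (ℕ.≡ᵇ⇒≡ y i eq) (chosen-sym c) ◅ linked-sound n l) ]′
            (∨⁻ t)) chosen (Any.any⁻ _ es some)

  rainbowColoured-sound : ∀ {h} ess → T (rainbowColoured h ess) → All Present (concat ess) → Rainbow₃ (_< h) Q (length ess)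
  rainbowColoured-sound {h} ess t qs = record
    { γ = pairColour ess
    ; γ-sym = λ i j → cong₂ (λ x y → colour ess (x , y)) (ℕ.⊓-comm i j) (ℕ.⊔-comm i j)
    ; join = join }
    where
    join : (s : Fin 3 → ℕ) → (∀ i → s i < h) →
           Σ[ pick ∈ (ℕ → ℕ × ℕ) ] (∀ i j → Star (Picked Q (pairColour ess) (length ess) pick) (s i) (s j))
    join s s<h with Any.satisfied (Any.any⁻ _ (choices ess)
                      (all-upTo⁻ _ h (all-upTo⁻ _ h (all-upTo⁻ _ h t (s<h zero)) (s<h (suc zero))) (s<h (suc (suc zero)))))
    ... | es , sp = nthEdge es , λ i j → reverse (chosen-sym ess qs es ok) (root i) ◅◅ root j
      where
      parts = ∧⁻ {linked (length ess) es (s zero) (s (suc zero))} sp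
      parts′ = ∧⁻ {linked (length ess) es (s zero) (s (suc (suc zero)))} (proj₂ parts)
      ok = proj₂ parts′
      root : ∀ i → Star (Picked Q (pairColour ess) (length ess) (nthEdge es)) (s zero) (s i)
      root zero = ε
      root (suc zero) = linked-sound ess qs es ok (length ess) (proj₁ parts)
      root (suc (suc zero)) = linked-sound ess qs es ok (length ess) (proj₁ parts′)

-- Refining contractions of graphs without cut vertices

module Relabel {N : ℕ} {G : Graph N} {h : ℕ} (M : Contraction G h) (f g : ℕ → ℕ)
  (f<h : ∀ {i} → i < h → f i < h) (g<h : ∀ {i} → i < h → g i < h)
  (g∘f : ∀ {i} → i < h → g (f i) ≡ i) (f∘g : ∀ {i} → i < h → f (g i) ≡ i) where

  open Contraction M

  relabelled : Contraction G h
  relabelled = record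
    { φ = g ∘ φ
    ; φ<h = g<h ∘ φ<h
    ; φ-surj = λ i<h → let (v , v∈ , eq) = φ-surj (f<h i<h) in v , v∈ , trans (cong g eq) (g∘f i<h)
    ; fibre = λ u∈ v∈ eq → Star.map (λ (e , eq) → e , cong g eq)
        (fibre u∈ v∈ (trans (sym (f∘g (φ<h u∈))) (trans (cong f eq) (f∘g (φ<h v∈))))) }

  quotient⁺ : ∀ {i j} → i < h → j < h → Quotient G φ (f i) (f j) → Quotient G (g ∘ φ) i j
  quotient⁺ i<h j<h (fi≢fj , u , v , e , p , q) =
    fi≢fj ∘ cong f , u , v , e , trans (cong g p) (g∘f i<h) , trans (cong g q) (g∘f j<h)

  quotient⁻ : ∀ {i j} → Quotient G (g ∘ φ) i j → Quotient G φ (f i) (f j)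
  quotient⁻ (i≢j , u , v , e , refl , refl) =
    (λ eq → i≢j (trans (sym (g∘f (g<h u<))) (trans (cong g eq) (g∘f (g<h v<))))) , u , v , e , sym (f∘g u<) , sym (f∘g v<)
    where
    u< = φ<h (adj-V G e)
    v< = φ<h (adj-V′ G e)

module TwoConnected {N : ℕ} (G : Graph N) (connected : Connected G) (nocut : NoCut G) where

  Has : ∀ {h} → Contraction G h → Edges → Set
  Has M = All (λ (i , j) → Quotient G (Contraction.φ M) i j)

  collide : ∀ {h} (M : Contraction G h) → h < order G → Contraction.Collision M
  collide {h} M h<n with Contraction.collision? M
  ... | yes c = c
  ... | no none = contradiction
          (∣-∣-injects h (V G) φ φ<h (no-collision⇒injective none)) (ℕ.<⇒≱ h<n)
    where open Contraction M

  record Grown {h} (M : Contraction G h) (w : ℕ) : Set where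
    field
      {a b} : Fin N
      sp    : Split G M w a b
    open Contraction (Split.M′ sp)
    field
      left  : ∃[ x ] (x < h × x ≢ w × Quotient G φ w x)
      right : ∃[ y ] (y < h × y ≢ w × Quotient G φ h y)

  -- Both parts of the fibre can be chosen to have neighbours in other fibres, because
  -- neither G nor G − a is disconnected; the new quotient is then again without a cut vertex.
  grow : ∀ {h w} (M : Contraction G h) → 2 ≤ h → let open Contraction M in
         ∀ {p q} → p ∈ V G → q ∈ V G → p ≢ q → φ p ≡ w → φ q ≡ w → Grown M w
  grow {h} {w} M 2≤h {p} {q} p∈ q∈ p≢q φp φq with other
    where
    open Contraction M
    other : ∃[ z ] (z ∈ V G × φ z ≢ w)
    other with w ≟ 0
    ... | yes ≡0 = let (z , z∈ , φz≡1) = φ-surj 2≤h in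
                   z , z∈ , λ eq → ℕ.1+n≢0 (trans (sym φz≡1) (trans eq ≡0))
    ... | no ≢0 = let (z , z∈ , φz≡0) = φ-surj (ℕ.<-trans z<s 2≤h) in
                  z , z∈ , λ eq → ≢0 (trans (sym eq) φz≡0)
  ... | z , z∈ , φz≢ with crossing (λ v → φ v ≟ w) (proj₂ connected p∈ z∈) φp φz≢
    where open Contraction M
  ... | a , a′ , ea , φa , φa′≢ with second
    where
    open Contraction M
    second : ∃[ r ] (r ∈ V G × r ≢ a × φ r ≡ w)
    second with p F.≟ a
    ... | yes p≡a = q , q∈ , (λ q≡a → p≢q (trans p≡a (sym q≡a))) , φq
    ... | no p≢a = p , p∈ , p≢a , φp
  -- The walk avoids `a`, so the vertex `b` at which it leaves the fibre differs from `a`.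
  ... | r , r∈ , r≢a , φr with crossing (λ v → φ v ≟ w)
                                (nocut a r∈ z∈ r≢a λ z≡a → φz≢ (trans (cong φ z≡a) φa)) φr φz≢
    where open Contraction M
  ... | b , b′ , (eb , b≢a , _) , φb , φb′≢ = record
    { sp = sp
    ; left = φ a′ , φ<h (adj-V′ G ea) , φa′≢ , φa′≢ ∘ sym , a , a′ , ea , Split.φa≡w sp , Split.away sp φa′≢
    ; right = φ b′ , φ<h (adj-V′ G eb) , φb′≢ , ℕ.<⇒≢ (φ<h (adj-V′ G eb)) ∘ sym , b , b′ , eb , Split.φb≡h sp , Split.away sp φb′≢ }
    where
    open Contraction M
    sp : Split G M w a b
    sp = subst (λ w → Split G M w a b) φa (split G M (adj-V G ea) (adj-V G eb) (b≢a ∘ sym) (trans φa (sym φb)))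

  Stage : ℕ → List Edges → Set
  Stage h ts = Σ[ M ∈ Contraction G h ] Any (Has M) ts

  module _ {h : ℕ} {M : Contraction G h} {w} (grown : Grown M w) where

    open Grown grown
    open Split sp
    open Contraction M′ using (φ)
    private
      module M = Contraction M

    quotient-< : ∀ {i j} → Quotient G M.φ i j → j < h
    quotient-< (_ , _ , _ , e , _ , refl) = M.φ<h (adj-V′ G e)

    splitEdges-present : ∀ {t} → Has M t → Has M′ (splitEdges w h t)
    splitEdges-present {t} has = w~h ∷ All.tabulate λ {(i , j)} e∈ →
      let (e∈t , i≢w , j≢w) = List∈.∈-filter⁻ (λ (i , j) → ¬? (i ≟ w) ×-dec ¬? (j ≟ w)) {xs = t} e∈
      in keep i≢w j≢w (All.lookup has e∈t)

    splitClauses-present : ∀ {t} → Has M t →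
                           All (Any λ (i , j) → Quotient G φ i j) (splitClauses w h t)
    splitClauses-present {t} has =
      All.++⁺ (All.concat⁺ (All.map⁺ (All.map (λ {e} → sides {e}) has))) (neighbour left ∷ neighbour right ∷ [])
      where
      neighbour : ∀ {v} → (∃[ x ] (x < h × x ≢ w × Quotient G φ v x)) →
                  Any (λ (i , j) → Quotient G φ i j) (map (v ,_) (avoiding w h))
      neighbour (x , x<h , x≢w , r) =
        Any.map⁺ (List∈.lose (List∈.∈-filter⁺ (λ x → ¬? (x ≟ w)) (List∈.∈-upTo⁺ x<h) x≢w) r)

      either : ∀ {j} → Quotient G φ w j ⊎ Quotient G φ h j →
               Any (λ (i , j) → Quotient G φ i j) ((w , j) ∷ (h , j) ∷ [])
      either (inj₁ r) = here r
      either (inj₂ r) = there (here r)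

      sides : ∀ {(i , j) : ℕ × ℕ} → Quotient G M.φ i j → All (Any λ (i , j) → Quotient G φ i j)
                (if i ≡ᵇ w then ((w , j) ∷ (h , j) ∷ []) ∷ [] else
                 if j ≡ᵇ w then ((w , i) ∷ (h , i) ∷ []) ∷ [] else [])
      sides {i , j} r with i ≡ᵇ w in eqᵢ | j ≡ᵇ w in eqⱼ
      ... | true | _ = either (share (quotient-< r) (subst (λ i → Quotient G M.φ i j) (ℕ.≡ᵇ⇒≡ i w (subst T (sym eqᵢ) tt)) r)) ∷ []
      ... | false | true = either (share (quotient-< (quotient-sym G r))
                             (quotient-sym G (subst (Quotient G M.φ i) (ℕ.≡ᵇ⇒≡ j w (subst T (sym eqⱼ) tt)) r))) ∷ []
      ... | false | false = []

  -- Which fibre has two vertices is beyond control, and so is the distribution of its edges between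
  -- the two parts. The check therefore covers every label `w` and every way to meet the clauses.
  advance : ∀ {h ts ts′} → splits h ts ts′ ≡ true → 2 ≤ h → h < order G → Stage h ts → Stage (suc h) ts′
  advance {h} {ts} {ts′} check 2≤h h<n (M , some) with collide M h<n
  ... | p , q , p∈ , q∈ , p≢q , eq = relabel (List∈.find copy)
    where
    w = Contraction.φ M p
    grown : Grown M w
    grown = grow M 2≤h p∈ q∈ p≢q refl (sym eq)
    M′ = Split.M′ (Grown.sp grown)
    Copy : Edges → Set
    Copy = Sound.Copy (Quotient G (Contraction.φ M′)) (quotient-sym G) (suc h)
    copy : Any Copy ts′
    copy = All.lookupWith (λ {t} t′ has →
      Sound.unavoidable-sound _ (quotient-sym G) (suc h) ts′ (splitEdges w h t) (splitClauses w h t)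
        (all-upTo⁻ _ h t′ (Contraction.φ<h M p∈)) (splitEdges-present grown has) (splitClauses-present grown has))
      (All.all⁺ _ ts (≡true⇒T check)) some
    relabel : ∃[ t ] (t List∈.∈ ts′ × Copy t) → Stage (suc h) ts′
    relabel (t , t∈ , c) = relabelled , List∈.lose t∈ (All.map (λ (i<h , j<h , r) → quotient⁺ i<h j<h r) edges)
      where
      open Sound.Copy c
      open Relabel M′ f g f<h g<h g∘f f∘g

-- Cyclic quotients and their rotations

Successive : ℕ → ℕ → ℕ → Set
Successive m i j = suc i ≡ j ⊎ suc i ≡ m × j ≡ 0

module Rotation (m : ℕ) where

  rot : ℕ → ℕ
  rot i = if i ≡ᵇ m then 0 else suc i

  unrot : ℕ → ℕ
  unrot zero = m
  unrot (suc i) = i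

  rot-last : rot m ≡ 0
  rot-last with m ≡ᵇ m in eq
  ... | true = refl
  ... | false = ⊥-elim (subst T eq (ℕ.≡⇒≡ᵇ m m refl))

  rot-≢ : ∀ {i} → i ≢ m → rot i ≡ suc i
  rot-≢ {i} i≢m with i ≡ᵇ m in eq
  ... | true = contradiction (ℕ.≡ᵇ⇒≡ i m (subst T (sym eq) tt)) i≢m
  ... | false = refl

  rot< : ∀ {i} → i < suc m → rot i < suc m
  rot< {i} i<1+m with i ≟ m
  ... | yes refl = subst (_< suc m) (sym rot-last) z<s
  ... | no i≢m = subst (_< suc m) (sym (rot-≢ i≢m)) (s<s (ℕ.≤∧≢⇒< (ℕ.≤-pred i<1+m) i≢m))

  unrot< : ∀ {i} → i < suc m → unrot i < suc m
  unrot< {zero} _ = ℕ.n<1+n m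
  unrot< {suc i} i< = ℕ.<-trans (ℕ.n<1+n i) i<

  rot∘unrot : ∀ {i} → i < suc m → rot (unrot i) ≡ i
  rot∘unrot {zero} _ = rot-last
  rot∘unrot {suc i} i< = rot-≢ (ℕ.<⇒≢ (ℕ.≤-pred i<))

  unrot∘rot : ∀ {i} → i < suc m → unrot (rot i) ≡ i
  unrot∘rot {i} _ with i ≟ m
  ... | yes refl = cong unrot rot-last
  ... | no i≢m = cong unrot (rot-≢ i≢m)

  unrot-successive : ∀ {i j} → j < suc m → Successive (suc m) i j → Successive (suc m) (unrot i) (unrot j)
  unrot-successive {zero} j< (inj₁ refl) = inj₂ (refl , refl)
  unrot-successive {suc i} j< (inj₁ refl) = inj₁ refl
  unrot-successive {zero} j< (inj₂ (refl , refl)) = inj₂ (refl , refl)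
  unrot-successive {suc i} j< (inj₂ (refl , refl)) = inj₁ refl

  rot-successive : ∀ {i j} → i < suc m → j < suc m → Successive (suc m) (unrot i) (unrot j) → Successive (suc m) i j
  rot-successive {zero} {suc j} i< j< (inj₁ refl) = contradiction (ℕ.<⇒≤ (ℕ.≤-pred j<)) ℕ.1+n≰n
  rot-successive {zero} {zero} i< j< (inj₁ eq) = contradiction (sym eq) (ℕ.<⇒≢ (ℕ.n<1+n m))
  rot-successive {suc i} {zero} i< j< (inj₁ eq) = inj₂ (cong suc eq , refl)
  rot-successive {suc i} {suc j} i< j< (inj₁ refl) = inj₁ refl
  rot-successive {zero} {zero} i< j< (inj₂ (_ , m≡0)) = inj₂ (cong suc (sym m≡0) , refl)
  rot-successive {zero} {suc j} i< j< (inj₂ (_ , refl)) = inj₁ refl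
  rot-successive {suc i} {j} i< j< (inj₂ (eq , _)) = contradiction (ℕ.suc-injective eq) (ℕ.<⇒≢ (ℕ.≤-pred i<))

module _ {N : ℕ} {G : Graph N} where

  Cyclic : ∀ {h} → Contraction G h → Set
  Cyclic {h} M = ∀ {i j} → i < h → j < h → Successive h i j → Quotient G (Contraction.φ M) i j

  ExactlyCyclic : ∀ {h} → Contraction G h → Set
  ExactlyCyclic {h} M = Cyclic M × (∀ {i j} → Quotient G (Contraction.φ M) i j → Successive h i j ⊎ Successive h j i)

  -- A first chord joins one of two freshly split parts to the neighbouring fibre of the other part,
  -- so it skips a single vertex of the cycle, and a rotation moves its ends to 0 and 2.
  Chorded : ∀ {h} → Contraction G h → Set
  Chorded M = Cyclic M × Quotient G (Contraction.φ M) 0 2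

  quotient-<₁ : ∀ {h} (M : Contraction G h) {i j} → Quotient G (Contraction.φ M) i j → i < h
  quotient-<₁ M (_ , _ , _ , e , refl , _) = Contraction.φ<h M (adj-V G e)

  module Rotate {m : ℕ} (M : Contraction G (suc m)) where

    open Contraction M using (φ)
    open Rotation m
    open Relabel M unrot rot unrot< rot< rot∘unrot unrot∘rot public

    rotate-cyclic : Cyclic M → Cyclic relabelled
    rotate-cyclic cyc i< j< s = quotient⁺ i< j< (cyc (unrot< i<) (unrot< j<) (unrot-successive j< s))

    rotate-exact : ExactlyCyclic M → ExactlyCyclic relabelled
    rotate-exact (cyc , exact) = rotate-cyclic cyc , λ r →
      let i< = quotient-<₁ relabelled r ; j< = quotient-<₁ relabelled (quotient-sym G r) in
      [ inj₁ ∘ rot-successive i< j< , inj₂ ∘ rot-successive j< i< ]′ (exact (quotient⁻ r))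

  -- Splitting gives the second part the new largest label. If the fibre to be split comes last on
  -- the cycle, its two parts carry consecutive labels and no other label has to move.
  rotate-to-last : ∀ d {m} (M : Contraction G (suc m)) → ExactlyCyclic M → ∀ {p q} →
    Contraction.φ M p ≡ Contraction.φ M q → Contraction.φ M p + d ≡ m →
    Σ[ M′ ∈ Contraction G (suc m) ] (ExactlyCyclic M′ × Contraction.φ M′ p ≡ m × Contraction.φ M′ q ≡ m)
  rotate-to-last zero M ex {p} φp≡φq φp+0≡m = M , ex , φp≡m , trans (sym φp≡φq) φp≡m
    where φp≡m = trans (sym (ℕ.+-identityʳ _)) φp+0≡m
  rotate-to-last (suc d) {m} M ex {p} φp≡φq eq =
    rotate-to-last d relabelled (rotate-exact ex) (cong rot φp≡φq)
      (trans (cong (_+ d) (rot-≢ φp≢m)) (trans (sym (ℕ.+-suc _ d)) eq))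
    where
    open Rotate M
    open Rotation m
    φp≢m : Contraction.φ M p ≢ m
    φp≢m ≡m = ℕ.m+1+n≢m _ (trans eq (sym ≡m))

  exact⇒cycle : ∀ {h} (M : Contraction G h) → 3 ≤ h → ¬ Contraction.Collision M → ExactlyCyclic M → IsCycle G
  exact⇒cycle {h} M 3≤h none (cyc , exact) = h , 3≤h , c , c-inj , (λ v → mk⇔ (to v) from) , adj⇔
    where
    open Contraction M
    inj : ∀ {u v} → u ∈ V G → v ∈ V G → φ u ≡ φ v → u ≡ v
    inj = no-collision⇒injective none
    c : Fin h → Fin N
    c i = proj₁ (φ-surj (F.toℕ<n i))
    c∈ : ∀ i → c i ∈ V G
    c∈ i = proj₁ (proj₂ (φ-surj (F.toℕ<n i)))
    φc : ∀ i → φ (c i) ≡ toℕ i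
    φc i = proj₂ (proj₂ (φ-surj (F.toℕ<n i)))
    c-inj : Injective _≡_ _≡_ c
    c-inj {i} {j} eq = F.toℕ-injective (trans (sym (φc i)) (trans (cong φ eq) (φc j)))
    to : ∀ v → v ∈ V G → ∃[ i ] c i ≡ v
    to v v∈ = fromℕ< (φ<h v∈) , inj (c∈ _) v∈ (trans (φc _) (F.toℕ-fromℕ< (φ<h v∈)))
    from : ∀ {v} → (∃[ i ] c i ≡ v) → v ∈ V G
    from (i , refl) = c∈ i
    edge : ∀ {i j} → Quotient G φ (toℕ i) (toℕ j) → Adj G (c i) (c j)
    edge {i} {j} (_ , u , v , e , p , q) =
      subst₂ (Adj G) (inj (adj-V G e) (c∈ i) (trans p (sym (φc i)))) (inj (adj-V′ G e) (c∈ j) (trans q (sym (φc j)))) e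
    adj⇔ : ∀ i j → Adj G (c i) (c j) ⇔ (Next {N} i j ⊎ Next {N} j i)
    adj⇔ i j = mk⇔
      (λ e → exact ((λ eq → adj-irrefl G (subst (λ z → Adj G (c i) (c z)) (sym (F.toℕ-injective eq)) e)) , c i , c j , e , φc i , φc j))
      [ (λ n → edge {i} {j} (cyc (F.toℕ<n i) (F.toℕ<n j) n)) ,
        (λ n → edge {i} {j} (quotient-sym G (cyc (F.toℕ<n j) (F.toℕ<n i) n))) ]′

-- Growing cycles

module Transposition (a b : ℕ) where

  transpose : ℕ → ℕ
  transpose i with i ≟ a | i ≟ b
  ... | yes _ | _ = b
  ... | no _ | yes _ = a
  ... | no _ | no _ = i

  transpose-a : transpose a ≡ b
  transpose-a with a ≟ a | a ≟ b
  ... | yes _ | _ = refl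
  ... | no ≢ | _ = contradiction refl ≢

  transpose-b : transpose b ≡ a
  transpose-b with b ≟ a | b ≟ b
  ... | yes eq | _ = eq
  ... | no _ | yes _ = refl
  ... | no _ | no ≢ = contradiction refl ≢

  transpose-≢ : ∀ {i} → i ≢ a → i ≢ b → transpose i ≡ i
  transpose-≢ {i} i≢a i≢b with i ≟ a | i ≟ b
  ... | yes eq | _ = contradiction eq i≢a
  ... | no _ | yes eq = contradiction eq i≢b
  ... | no _ | no _ = refl

  transpose-< : ∀ {h i} → a < h → b < h → i < h → transpose i < h
  transpose-< {i = i} a<h b<h i<h with i ≟ a | i ≟ b
  ... | yes _ | _ = b<h
  ... | no _ | yes _ = a<h
  ... | no _ | no _ = i<h

  transpose-involutive : ∀ i → transpose (transpose i) ≡ i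
  transpose-involutive i = cases (i ≟ a) (i ≟ b)
    where
    cases : Dec (i ≡ a) → Dec (i ≡ b) → transpose (transpose i) ≡ i
    cases (yes refl) _ = trans (cong transpose transpose-a) transpose-b
    cases (no _) (yes refl) = trans (cong transpose transpose-b) transpose-a
    cases (no i≢a) (no i≢b) = trans (cong transpose (transpose-≢ i≢a i≢b)) (transpose-≢ i≢a i≢b)

module _ {N : ℕ} {G : Graph N} where

  CycleOrChorded : ℕ → Set
  CycleOrChorded h = (Σ[ M ∈ Contraction G h ] ExactlyCyclic M) ⊎ (Σ[ M ∈ Contraction G h ] Chorded M)

  -- What remains of an exact cycle 0, 1, …, m + 1 after its last fibre is split into m + 1 and m + 2.
  record Opened {m} (M : Contraction G (3 + m)) : Set where
    open Contraction M
    field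
      path  : ∀ {i} → i < m → Quotient G φ i (suc i)
      ends  : Quotient G φ (suc m) (2 + m)
      inner : ∀ {i j} → i ≤ m → j ≤ m → Quotient G φ i j → Successive (2 + m) i j ⊎ Successive (2 + m) j i
      outer : ∀ {i j} → i ≡ suc m ⊎ i ≡ 2 + m → j ≤ m → Quotient G φ i j → j ≡ m ⊎ j ≡ 0

  module _ {m} {M : Contraction G (3 + m)} (opened : Opened M) where

    open Contraction M
    open Opened opened

    private
      left right : ℕ
      left = suc m
      right = 2 + m

    module _ (left~m : Quotient G φ left m) (right~0 : Quotient G φ right 0) where

      cyclic-closure : Cyclic M
      cyclic-closure {i} i< j< (inj₁ refl) with ℕ.<-cmp i m
      ... | tri< i<m _ _ = path i<m
      ... | tri≈ _ refl _ = quotient-sym G left~m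
      ... | tri> _ _ m<i with ℕ.m≤n⇒m<n∨m≡n m<i
      ...   | inj₂ refl = ends
      ...   | inj₁ 1+m<i = contradiction (ℕ.≤-pred (ℕ.≤-pred j<)) (ℕ.<⇒≱ 1+m<i)
      cyclic-closure i< j< (inj₂ (refl , refl)) = right~0

      -- Two adjacencies are left open: `left` with 0, and `m` with `right`. Each skips one vertex
      -- of the cycle; two rotations carry the former to 0, 2 and three rotations carry the latter
      -- there.
      close : CycleOrChorded (3 + m)
      close with quotient? G φ left 0 | quotient? G φ m right
      ... | yes chord | _ = inj₂ (R₂.relabelled , R₂.rotate-cyclic (R₁.rotate-cyclic cyclic-closure) ,
              R₂.quotient⁺ z<s (s<s (s<s z<s)) (R₁.quotient⁺ (ℕ.n<1+n _) (s<s z<s) chord))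
        where
        module R₁ = Rotate M
        module R₂ = Rotate R₁.relabelled
      ... | no _ | yes chord = inj₂ (R₃.relabelled , R₃.rotate-cyclic (R₂.rotate-cyclic (R₁.rotate-cyclic cyclic-closure)) ,
              R₃.quotient⁺ z<s (s<s (s<s z<s)) (R₂.quotient⁺ (ℕ.n<1+n _) (s<s z<s)
                (R₁.quotient⁺ (ℕ.m<n⇒m<1+n (ℕ.n<1+n _)) z<s chord)))
        where
        module R₁ = Rotate M
        module R₂ = Rotate R₁.relabelled
        module R₃ = Rotate R₂.relabelled
      ... | no ¬left | no ¬right = inj₁ (M , cyclic-closure , exact)
        where
        data Position (i : ℕ) : Set where
          at-most : i ≤ m → Position i
          at-end  : i ≡ left ⊎ i ≡ right → Position i

        position : ∀ {i} → i < 3 + m → Position i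
        position {i} i< with ℕ.<-cmp i left
        ... | tri< i<left _ _ = at-most (ℕ.≤-pred i<left)
        ... | tri≈ _ eq _ = at-end (inj₁ eq)
        ... | tri> _ _ left<i = at-end (inj₂ (ℕ.≤-antisym (ℕ.≤-pred i<) left<i))

        from-end : ∀ {i j} → i ≡ left ⊎ i ≡ right → j ≤ m → Quotient G φ i j →
                   Successive (3 + m) i j ⊎ Successive (3 + m) j i
        from-end end j≤m r with end | outer end j≤m r
        ... | inj₁ refl | inj₁ refl = inj₂ (inj₁ refl)
        ... | inj₁ refl | inj₂ refl = contradiction r ¬left
        ... | inj₂ refl | inj₁ refl = contradiction (quotient-sym G r) ¬right
        ... | inj₂ refl | inj₂ refl = inj₁ (inj₂ (refl , refl))

        along : ∀ {i j} → i ≤ m → Successive (2 + m) i j → Successive (3 + m) i j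
        along i≤m (inj₁ eq) = inj₁ eq
        along i≤m (inj₂ (refl , _)) = contradiction i≤m ℕ.1+n≰n

        exact : ∀ {i j} → Quotient G φ i j → Successive (3 + m) i j ⊎ Successive (3 + m) j i
        exact r with position (quotient-<₁ M r) | position (quotient-<₁ M (quotient-sym G r))
        ... | at-most i≤m | at-most j≤m = [ inj₁ ∘ along i≤m , inj₂ ∘ along j≤m ]′ (inner i≤m j≤m r)
        ... | at-end end | at-most j≤m = from-end end j≤m r
        ... | at-most i≤m | at-end end = [ inj₂ , inj₁ ]′ (from-end end i≤m (quotient-sym G r))
        ... | at-end (inj₁ refl) | at-end (inj₁ refl) = contradiction refl (proj₁ r)
        ... | at-end (inj₁ refl) | at-end (inj₂ refl) = inj₁ (inj₁ refl)
        ... | at-end (inj₂ refl) | at-end (inj₁ refl) = inj₂ (inj₁ refl)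
        ... | at-end (inj₂ refl) | at-end (inj₂ refl) = contradiction refl (proj₁ r)

    open Transposition left right

    private
      left< : left < 3 + m
      left< = ℕ.m<n⇒m<1+n (ℕ.n<1+n _)
      right< : right < 3 + m
      right< = ℕ.n<1+n _

      fixed : ∀ {i} → i ≤ m → transpose i ≡ i
      fixed i≤m = transpose-≢ (λ { refl → ℕ.1+n≰n i≤m }) (λ { refl → ℕ.1+n≰n (ℕ.<⇒≤ i≤m) })

      ≤m⇒< : ∀ {i} → i ≤ m → i < 3 + m
      ≤m⇒< i≤m = ℕ.m<n⇒m<1+n (ℕ.m<n⇒m<1+n (s≤s i≤m))

    module Exchange = Relabel M transpose transpose (transpose-< left< right<) (transpose-< left< right<)
                        (λ _ → transpose-involutive _) (λ _ → transpose-involutive _)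
    open Exchange

    exchanged : Opened relabelled
    exchanged = record
      { path = λ i<m → quotient⁺ (≤m⇒< (ℕ.<⇒≤ i<m)) (≤m⇒< i<m)
                 (subst₂ (Quotient G φ) (sym (fixed (ℕ.<⇒≤ i<m))) (sym (fixed i<m)) (path i<m))
      ; ends = quotient⁺ left< right< (subst₂ (Quotient G φ) (sym transpose-a) (sym transpose-b) (quotient-sym G ends))
      ; inner = λ i≤m j≤m r → inner i≤m j≤m (subst₂ (Quotient G φ) (fixed i≤m) (fixed j≤m) (quotient⁻ r))
      ; outer = λ {i} end j≤m r → outer (swap-end end) j≤m (subst (Quotient G φ (transpose i)) (fixed j≤m) (quotient⁻ r)) }
      where
      swap-end : ∀ {i} → i ≡ left ⊎ i ≡ right → transpose i ≡ left ⊎ transpose i ≡ right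
      swap-end (inj₁ refl) = inj₂ transpose-a
      swap-end (inj₂ refl) = inj₁ transpose-b

  split-opens : ∀ {m} {M : Contraction G (2 + m)} {a b} → ExactlyCyclic M → (sp : Split G M (suc m) a b) → Opened (Split.M′ sp)
  split-opens {m} {M} (cyc , exact) sp = record
    { path = λ i<m → keep (ℕ.<⇒≢ (ℕ.m<n⇒m<1+n i<m)) (ℕ.<⇒≢ (s<s i<m))
                       (cyc (ℕ.m<n⇒m<1+n (ℕ.m<n⇒m<1+n i<m)) (s<s (ℕ.m<n⇒m<1+n i<m)) (inj₁ refl))
    ; ends = w~h
    ; inner = λ i≤m j≤m r → exact (forget (≤⇒≢ i≤m) (≤⇒≢′ i≤m) (≤⇒≢ j≤m) (≤⇒≢′ j≤m) r)
    ; outer = λ end j≤m r → neighbour j≤m (exact (forget-w end (≤⇒≢ j≤m) (≤⇒≢′ j≤m) r)) }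
    where
    open Split sp
    ≤⇒≢ : ∀ {i} → i ≤ m → i ≢ suc m
    ≤⇒≢ i≤m refl = ℕ.1+n≰n i≤m
    ≤⇒≢′ : ∀ {i} → i ≤ m → i ≢ 2 + m
    ≤⇒≢′ i≤m refl = ℕ.1+n≰n (ℕ.<⇒≤ i≤m)
    neighbour : ∀ {j} → j ≤ m → Successive (2 + m) (suc m) j ⊎ Successive (2 + m) j (suc m) → j ≡ m ⊎ j ≡ 0
    neighbour j≤m (inj₁ (inj₁ refl)) = contradiction (ℕ.<⇒≤ j≤m) ℕ.1+n≰n
    neighbour j≤m (inj₁ (inj₂ (_ , ≡0))) = inj₂ ≡0
    neighbour j≤m (inj₂ (inj₁ eq)) = inj₁ (ℕ.suc-injective eq)

  -- If both parts do not attach to the two neighbouring fibres in order, they do in reverse order.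
  opened-closes : ∀ {m} {M : Contraction G (3 + m)} → Opened M → let open Contraction M in
                  Quotient G φ (suc m) m ⊎ Quotient G φ (suc m) 0 → Quotient G φ (2 + m) m ⊎ Quotient G φ (2 + m) 0 →
                  Quotient G φ (suc m) m ⊎ Quotient G φ (2 + m) m → Quotient G φ (suc m) 0 ⊎ Quotient G φ (2 + m) 0 →
                  CycleOrChorded (3 + m)
  opened-closes {m} {M} op = go
    where
    open Contraction M
    module X = Exchange op
    open Transposition (suc m) (2 + m)
    reversed : Quotient G φ (suc m) 0 → Quotient G φ (2 + m) m → CycleOrChorded (3 + m)
    reversed l r = close (exchanged op)
      (X.quotient⁺ (ℕ.m<n⇒m<1+n (ℕ.n<1+n _)) (ℕ.m<n⇒m<1+n (ℕ.m<n⇒m<1+n (ℕ.n<1+n m)))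
        (subst₂ (Quotient G φ) (sym transpose-a) (sym (transpose-≢ (ℕ.<⇒≢ (ℕ.n<1+n m)) (ℕ.<⇒≢ (ℕ.m<n⇒m<1+n (ℕ.n<1+n m))))) r))
      (X.quotient⁺ (ℕ.n<1+n _) z<s
        (subst₂ (Quotient G φ) (sym transpose-b) (sym (transpose-≢ (λ ()) (λ ()))) l))
    go : Quotient G φ (suc m) m ⊎ Quotient G φ (suc m) 0 → Quotient G φ (2 + m) m ⊎ Quotient G φ (2 + m) 0 →
         Quotient G φ (suc m) m ⊎ Quotient G φ (2 + m) m → Quotient G φ (suc m) 0 ⊎ Quotient G φ (2 + m) 0 →
         CycleOrChorded (3 + m)
    -- The bipartite graph between the two parts and the two neighbouring fibres has no isolated
    -- vertex; on 2 + 2 vertices this forces a perfect matching, which the cases read off.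
    go (inj₁ lm) (inj₂ r0) _ _ = close op lm r0
    go (inj₁ lm) (inj₁ _) _ (inj₂ r0) = close op lm r0
    go (inj₁ _) (inj₁ rm) _ (inj₁ l0) = reversed l0 rm
    go (inj₂ l0) (inj₁ rm) _ _ = reversed l0 rm
    go (inj₂ _) (inj₂ r0) (inj₁ lm) _ = close op lm r0
    go (inj₂ l0) (inj₂ _) (inj₂ rm) _ = reversed l0 rm

  module _ {h} (M : Contraction G (2 + h)) (link : Quotient G (Contraction.φ M) h (suc h)) where

    open Contraction M

    private
      x = proj₁ (proj₂ link)
      y = proj₁ (proj₂ (proj₂ link))
      x~y : Adj G x y
      x~y = proj₁ (proj₂ (proj₂ (proj₂ link)))
      φx : φ x ≡ h
      φx = proj₁ (proj₂ (proj₂ (proj₂ (proj₂ link))))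
      φy : φ y ≡ suc h
      φy = proj₂ (proj₂ (proj₂ (proj₂ (proj₂ link))))

      InFibre : Fin N → Fin N → Set
      InFibre u v = Adj G u v × φ u ⊓ h ≡ φ v ⊓ h

      old : ∀ {u v} → u ∈ V G → v ∈ V G → φ u ≡ φ v → Star InFibre u v
      old u∈ v∈ eq = Star.map (λ (e , eq) → e , cong (_⊓ h) eq) (fibre u∈ v∈ eq)

      to-x : ∀ {u} → u ∈ V G → h ≤ φ u → Star InFibre u x
      to-x {u} u∈ h≤φu with ℕ.m≤n⇒m<n∨m≡n h≤φu
      ... | inj₂ h≡φu = old u∈ (adj-V G x~y) (trans (sym h≡φu) (sym φx))
      ... | inj₁ h<φu = old u∈ (adj-V′ G x~y) (trans (ℕ.≤-antisym (ℕ.≤-pred (φ<h u∈)) h<φu) (sym φy)) ◅◅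
              (adj-sym G x~y , trans (cong (_⊓ h) φy) (trans (ℕ.m≥n⇒m⊓n≡n (ℕ.n≤1+n h))
                                 (trans (sym (ℕ.⊓-idem h)) (cong (_⊓ h) (sym φx))))) ◅ ε

      new : ∀ {u v} → u ∈ V G → v ∈ V G → φ u ⊓ h ≡ φ v ⊓ h → Star InFibre u v
      new {u} {v} u∈ v∈ eq with ℕ.≤-total h (φ u) | ℕ.≤-total h (φ v)
      ... | inj₁ h≤φu | inj₁ h≤φv = to-x u∈ h≤φu ◅◅
              reverse (λ (e , eq) → adj-sym G e , sym eq) (to-x v∈ h≤φv)
      ... | inj₂ φu≤h | inj₂ φv≤h = old u∈ v∈ (trans (sym (ℕ.m≤n⇒m⊓n≡m φu≤h)) (trans eq (ℕ.m≤n⇒m⊓n≡m φv≤h)))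
      ... | inj₁ h≤φu | inj₂ φv≤h = to-x u∈ h≤φu ◅◅ reverse (λ (e , eq) → adj-sym G e , sym eq)
              (to-x v∈ (ℕ.≤-reflexive (trans (sym (ℕ.m≥n⇒m⊓n≡n h≤φu)) (trans eq (ℕ.m≤n⇒m⊓n≡m φv≤h)))))
      ... | inj₂ φu≤h | inj₁ h≤φv =
              to-x u∈ (ℕ.≤-reflexive (trans (sym (ℕ.m≥n⇒m⊓n≡n h≤φv)) (trans (sym eq) (ℕ.m≤n⇒m⊓n≡m φu≤h)))) ◅◅
              reverse (λ (e , eq) → adj-sym G e , sym eq) (to-x v∈ h≤φv)

    -- All labels are below h + 2, so capping them at `h` identifies just `h` and h + 1.
    merged : Contraction G (suc h)
    merged = record
      { φ = λ v → φ v ⊓ h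
      ; φ<h = λ {v} _ → s≤s (ℕ.m⊓n≤n (φ v) h)
      ; φ-surj = λ i< → let (v , v∈ , eq) = φ-surj (ℕ.m<n⇒m<1+n i<) in
                        v , v∈ , trans (cong (_⊓ h) eq) (ℕ.m≤n⇒m⊓n≡m (ℕ.≤-pred i<))
      ; fibre = new }

    merged-quotient : ∀ {i j i′ j′} → Quotient G φ i j → i ⊓ h ≡ i′ → j ⊓ h ≡ j′ → i′ ≢ j′ →
                      Quotient G (Contraction.φ merged) i′ j′
    merged-quotient (_ , u , v , e , refl , refl) refl refl ≢ = ≢ , u , v , e , refl , refl

  -- The cycle gets shorter by one, while `2 ≤ h` leaves the labels 0 and 2 of the chord unchanged.
  merge-last : ∀ {h} → 2 ≤ h → (M : Contraction G (2 + h)) → Chorded M → Σ[ M′ ∈ Contraction G (suc h) ] Chorded M′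
  merge-last {h} 2≤h M (cyc , chord) = merged M link , cyc′ , merged-quotient M link chord refl (ℕ.m≤n⇒m⊓n≡m 2≤h) λ ()
    where
    link = cyc (ℕ.m<n⇒m<1+n (ℕ.n<1+n h)) (ℕ.n<1+n _) (inj₁ refl)
    cyc′ : Cyclic (merged M link)
    cyc′ {i} i< j< (inj₁ refl) =
      merged-quotient M link (cyc (ℕ.m<n⇒m<1+n i<) (ℕ.m<n⇒m<1+n j<) (inj₁ refl))
        (ℕ.m≤n⇒m⊓n≡m (ℕ.≤-pred i<)) (ℕ.m≤n⇒m⊓n≡m (ℕ.≤-pred j<)) (ℕ.<⇒≢ (ℕ.n<1+n i))
    cyc′ i< j< (inj₂ (refl , refl)) =
      merged-quotient M link (cyc (ℕ.n<1+n _) z<s (inj₂ (refl , refl)))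
        (ℕ.m≥n⇒m⊓n≡n (ℕ.n≤1+n h)) refl (λ h≡0 → ℕ.n≮0 (subst (2 ≤_) h≡0 2≤h))

-- Savings of graphs without cut vertices

<ᵇ-sound : ∀ {m n} → T (m <ᵇ n) → m < n
<ᵇ-sound = ℕ.<ᵇ⇒< _ _

cycleEdge chordedCycleEdge : ℕ → ℕ × ℕ → Bool
cycleEdge h (i , j) = (i <ᵇ h) ∧ ((j <ᵇ h) ∧ ((suc i ≡ᵇ j) ∨ ((i ≡ᵇ 0) ∧ (suc j ≡ᵇ h))))
chordedCycleEdge h e = cycleEdge h e ∨ (e ≐ (0 , 2))

wellColoured : ℕ → ℕ → List Edges → Bool
wellColoured d h ess = (length ess + d <ᵇ suc h) ∧ rainbowColoured h ess

cycle₄-wellColoured : wellColoured 2 4 cycle₄ ≡ true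
cycle₄-wellColoured = refl

gadgets₇-wellColoured : all (wellColoured 3 7) gadgets₇ ≡ true
gadgets₇-wellColoured = refl

splits₄ : splits 4 templates₄ templates₅ ≡ true
splits₄ = refl

splits₅ : splits 5 templates₅ templates₆ ≡ true
splits₅ = refl

splits₆ : splits 6 templates₆ templates₇ ≡ true
splits₆ = refl

module _ {N : ℕ} (G : Graph N) (connected : Connected G) (nocut : NoCut G) where

  open TwoConnected G connected nocut

  point : Contraction G 1
  point = record
    { φ = λ _ → 0 ; φ<h = λ _ → z<s
    ; φ-surj = λ { {zero} _ → proj₁ (proj₁ connected) , proj₂ (proj₁ connected) , refl ; {suc _} (s≤s ()) }
    ; fibre = λ u∈ v∈ _ → Star.map (λ e → e , refl) (proj₂ connected u∈ v∈) }

  -- After the second split each new part has a neighbour outside both parts, which can only be the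
  -- third fibre; the parts themselves are adjacent.
  triangle : 3 ≤ order G → Σ[ M ∈ Contraction G 3 ] ExactlyCyclic M
  triangle 3≤n with collide point (ℕ.<-trans (ℕ.n<1+n 1) 3≤n)
  ... | _ , _ , p∈ , q∈ , p≢q , eq = from-two (Split.M′ (split G point p∈ q∈ p≢q eq))
    where
    complete : (M : Contraction G 3) → let Q = Quotient G (Contraction.φ M) in
               ∀ {w} → w < 2 → Q w 2 → ∃[ x ] (x < 2 × x ≢ w × Q w x) → ∃[ y ] (y < 2 × y ≢ w × Q 2 y) →
               ExactlyCyclic M
    complete M {w} w<2 w~2 x y = cyc , exact
      where
      Q = Quotient G (Contraction.φ M)
      pairs : ∀ {w} → w < 2 → Q w 2 → ∃[ x ] (x < 2 × x ≢ w × Q w x) → ∃[ y ] (y < 2 × y ≢ w × Q 2 y) →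
              Q 0 1 × Q 1 2 × Q 2 0
      pairs {0} _ r (0 , _ , ≢ , _) _ = contradiction refl ≢
      pairs {0} _ r (1 , _ , _ , s) (0 , _ , ≢ , _) = contradiction refl ≢
      pairs {0} _ r (1 , _ , _ , s) (1 , _ , _ , t) = s , quotient-sym G t , quotient-sym G r
      pairs {1} _ r (1 , _ , ≢ , _) _ = contradiction refl ≢
      pairs {1} _ r (0 , _ , _ , s) (1 , _ , ≢ , _) = contradiction refl ≢
      pairs {1} _ r (0 , _ , _ , s) (0 , _ , _ , t) = quotient-sym G s , r , t
      pairs {0} _ r (1 , _ , _ , s) (suc (suc _) , s≤s (s≤s ()) , _)
      pairs {0} _ r (suc (suc _) , s≤s (s≤s ()) , _) _
      pairs {1} _ r (0 , _ , _ , s) (suc (suc _) , s≤s (s≤s ()) , _)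
      pairs {1} _ r (suc (suc _) , s≤s (s≤s ()) , _) _
      pairs {suc (suc _)} (s≤s (s≤s ()))
      cyc : Cyclic M
      cyc {0} i< j< (inj₁ refl) = proj₁ (pairs w<2 w~2 x y)
      cyc {1} i< j< (inj₁ refl) = proj₁ (proj₂ (pairs w<2 w~2 x y))
      cyc {suc (suc _)} i< (s≤s (s≤s (s≤s ()))) (inj₁ refl)
      cyc i< j< (inj₂ (refl , refl)) = proj₂ (proj₂ (pairs w<2 w~2 x y))
      near : ∀ {i j} → i < 3 → j < 3 → i ≢ j → Successive 3 i j ⊎ Successive 3 j i
      near {0} {0} _ _ ≢ = contradiction refl ≢
      near {0} {1} _ _ _ = inj₁ (inj₁ refl)
      near {0} {2} _ _ _ = inj₂ (inj₂ (refl , refl))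
      near {1} {0} _ _ _ = inj₂ (inj₁ refl)
      near {1} {1} _ _ ≢ = contradiction refl ≢
      near {1} {2} _ _ _ = inj₁ (inj₁ refl)
      near {2} {0} _ _ _ = inj₁ (inj₂ (refl , refl))
      near {2} {1} _ _ _ = inj₂ (inj₁ refl)
      near {2} {2} _ _ ≢ = contradiction refl ≢
      near {suc (suc (suc _))} (s≤s (s≤s (s≤s ())))
      near {_} {suc (suc (suc _))} _ (s≤s (s≤s (s≤s ())))
      exact : ∀ {i j} → Q i j → Successive 3 i j ⊎ Successive 3 j i
      exact r = near (quotient-<₁ M r) (quotient-<₁ M (quotient-sym G r)) (proj₁ r)
    from-two : Contraction G 2 → Σ[ M ∈ Contraction G 3 ] ExactlyCyclic M
    from-two M with collide M 3≤n
    ... | _ , _ , p∈ , q∈ , p≢q , eq = from-grown (grow M ℕ.≤-refl p∈ q∈ p≢q refl (sym eq))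
      where
      from-grown : ∀ {w} → Grown M w → Σ[ M ∈ Contraction G 3 ] ExactlyCyclic M
      from-grown grown = let open Grown grown in Split.M′ sp , complete (Split.M′ sp) (Split.w<h sp) (Split.w~h sp) left right

  grown-closes : ∀ {m} {M : Contraction G (2 + m)} → ExactlyCyclic M → Grown M (suc m) → CycleOrChorded {G = G} (3 + m)
  grown-closes {m} ex@(cyc , _) grown =
    opened-closes opened (neighbour (inj₁ refl) left) (neighbour (inj₂ refl) right)
      (share (ℕ.m<n⇒m<1+n (ℕ.n<1+n m)) (quotient-sym G (cyc (ℕ.m<n⇒m<1+n (ℕ.n<1+n m)) (ℕ.n<1+n _) (inj₁ refl))))
      (share z<s (cyc (ℕ.n<1+n _) z<s (inj₂ (refl , refl))))
    where
    open Grown grown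
    open Split sp
    opened : Opened M′
    opened = split-opens ex sp
    neighbour : ∀ {i} → i ≡ suc m ⊎ i ≡ 2 + m → ∃[ x ] (x < 2 + m × x ≢ suc m × Quotient G (Contraction.φ M′) i x) →
                Quotient G (Contraction.φ M′) i m ⊎ Quotient G (Contraction.φ M′) i 0
    neighbour {i} end (x , x< , x≢ , r) with Opened.outer opened end (ℕ.≤-pred (ℕ.≤∧≢⇒< (ℕ.≤-pred x<) x≢)) r
    ... | inj₁ refl = inj₁ r
    ... | inj₂ refl = inj₂ r

  lengthen : ∀ {m} (M : Contraction G (2 + m)) → ExactlyCyclic M → Contraction.Collision M → CycleOrChorded {G = G} (3 + m)
  lengthen {m} M ex (p , q , p∈ , q∈ , p≢q , eq)
    with rotate-to-last (suc m ∸ Contraction.φ M p) M ex eq (ℕ.m+[n∸m]≡n (ℕ.≤-pred (Contraction.φ<h M p∈)))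
  ... | M′ , ex′ , φp , φq = grown-closes ex′ (grow M′ (s≤s (s≤s z≤n)) p∈ q∈ p≢q φp φq)

  -- The fuel `t` bounds how often the cycle can still be lengthened, as no quotient has more
  -- vertices than `G`.
  cycle-or-chorded : ∀ t {m} (M : Contraction G (2 + m)) → 1 ≤ m → ExactlyCyclic M → order G ≤ 2 + m + t →
                     IsCycle G ⊎ ∃[ s ] (Σ[ M ∈ Contraction G (4 + s) ] Chorded M)
  continue : ∀ t {m} → order G ≤ 3 + m + t → CycleOrChorded {G = G} (4 + m) →
             IsCycle G ⊎ ∃[ s ] (Σ[ M ∈ Contraction G (4 + s) ] Chorded M)
  cycle-or-chorded t {suc m} M _ ex n≤ =
    [ (λ c → continue t n≤ (lengthen M ex c)) , (λ none → inj₁ (exact⇒cycle M (s≤s (s≤s (s≤s z≤n))) none ex)) ]′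
      (toSum (Contraction.collision? M))
  continue _ {m} n≤ (inj₂ chorded) = inj₂ (m , chorded)
  continue zero n≤ (inj₁ (M , _)) =
    contradiction (ℕ.≤-trans (Contraction.h≤order M) (subst (order G ≤_) (ℕ.+-identityʳ _) n≤)) ℕ.1+n≰n
  continue (suc t) {m} n≤ (inj₁ (M , ex)) = cycle-or-chorded t M (s≤s z≤n) ex (subst (order G ≤_) (ℕ.+-suc (3 + m) t) n≤)

  cycleEdge-sound : ∀ {h} {M : Contraction G h} → Cyclic M → ∀ {i j} → T (cycleEdge h (i , j)) → Quotient G (Contraction.φ M) i j
  cycleEdge-sound {h} cyc {i} {j} t =
    let (i< , t′) = ∧⁻ {i <ᵇ h} t
        (j< , t″) = ∧⁻ {j <ᵇ h} t′
    in [ (λ eq → cyc (<ᵇ-sound i<) (<ᵇ-sound j<) (inj₁ (ℕ.≡ᵇ⇒≡ (suc i) j eq))) ,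
         (λ t → let (i≡0 , eq) = ∧⁻ {i ≡ᵇ 0} t in
                quotient-sym G (cyc (<ᵇ-sound j<) (<ᵇ-sound i<) (inj₂ (ℕ.≡ᵇ⇒≡ (suc j) h eq , ℕ.≡ᵇ⇒≡ i 0 i≡0)))) ]′
       (∨⁻ {suc i ≡ᵇ j} t″)

  chorded-has : ∀ {h} {M : Contraction G h} t → T (all (chordedCycleEdge h) t) → Chorded M → Has M t
  chorded-has {h} {M} t check (cyc , chord) =
    All.map (λ {e} ok → [ cycleEdge-sound {M = M} cyc , (λ eq → subst (λ (i , j) → Quotient G _ i j) (sym (≐-sound {e} eq)) chord) ]′
                          (∨⁻ {cycleEdge h e} ok)) (All.all⁺ _ t check)

  gadget-deficient : ∀ {d h ess} → 1 ≤ h → (M : Contraction G h) → Has M (concat ess) → wellColoured d h ess ≡ true → Deficient G d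
  gadget-deficient {d} {h} {ess} 1≤h M has ok =
    let (k+d≤h , coloured) = ∧⁻ {length ess + d <ᵇ suc h} (≡true⇒T ok) in
    expand (order G) M (ℕ.m≤n+m _ h)
      (Sound.rainbowColoured-sound (Quotient G (Contraction.φ M)) (quotient-sym G) ess coloured has)
      (ℕ.≤-pred (<ᵇ-sound k+d≤h)) 1≤h

  -- One vertex with no colours already has deficiency 1; expanding it spends one new colour on each
  -- further vertex, which is the spanning tree colouring.
  deficient₁ : Deficient G 1
  deficient₁ = gadget-deficient {1} {1} {[]} z<s point [] refl

  deficient₂ : 4 ≤ order G → Deficient G 2
  deficient₂ 4≤n = square (triangle (ℕ.<⇒≤ 4≤n))
    where
    finish : (M : Contraction G 4) → Cyclic M → Deficient G 2
    finish M cyc = gadget-deficient {2} {4} {cycle₄} z<s M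
      (All.map (cycleEdge-sound {M = M} cyc) (All.all⁺ (cycleEdge 4) (concat cycle₄) tt)) cycle₄-wellColoured
    square : (Σ[ M ∈ Contraction G 3 ] ExactlyCyclic M) → Deficient G 2
    square (M , ex) = [ (λ (M , cyc , _) → finish M cyc) , (λ (M , cyc , _) → finish M cyc) ]′
                        (lengthen M ex (collide M 4≤n))

  module _ (7≤n : 7 ≤ order G) where

    reach₅ : Stage 4 templates₄ → Stage 5 templates₅
    reach₅ = advance {4} {templates₄} {templates₅} splits₄ (s≤s (s≤s z≤n)) (ℕ.≤-trans (ℕ.m≤m+n 5 2) 7≤n)

    reach₆ : Stage 5 templates₅ → Stage 6 templates₆
    reach₆ = advance {5} {templates₅} {templates₆} splits₅ (s≤s (s≤s z≤n)) (ℕ.≤-trans (ℕ.m≤m+n 6 1) 7≤n)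

    reach₇ : Stage 6 templates₆ → Stage 7 templates₇
    reach₇ = advance {6} {templates₆} {templates₇} splits₆ (s≤s (s≤s z≤n)) 7≤n

    -- The chorded cycle heads the list of templates at each of the orders 4 to 7, so the chain of
    -- splits can be entered at any of them; longer cycles are first shortened to order 7.
    reach : ∀ s → (M : Contraction G (4 + s)) → Chorded M → Stage 7 templates₇
    reach 0 M ch = reach₇ (reach₆ (reach₅ (M , here (chorded-has {M = M} _ tt ch))))
    reach 1 M ch = reach₇ (reach₆ (M , here (chorded-has {M = M} _ tt ch)))
    reach 2 M ch = reach₇ (M , here (chorded-has {M = M} _ tt ch))
    reach 3 M ch = M , here (chorded-has {M = M} _ tt ch)
    reach (suc (suc (suc (suc s)))) M ch = let (M′ , ch′) = merge-last (s≤s (s≤s z≤n)) M ch in reach (suc (suc (suc s))) M′ ch′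

    stage-deficient : Stage 7 templates₇ → Deficient G 3
    stage-deficient (M , some) = All.lookupWith {P = λ ess → wellColoured 3 7 ess ≡ true}
      (λ {ess} ok has → gadget-deficient {3} {7} {ess} z<s M has ok)
      (all≡true (wellColoured 3 7) gadgets₇ gadgets₇-wellColoured) (Any.map⁻ some)

    deficient₃ : ¬ IsCycle G → Deficient G 3
    deficient₃ not-cycle = from-triangle (triangle (ℕ.≤-trans (ℕ.m≤m+n 3 4) 7≤n))
      where
      from-triangle : (Σ[ M ∈ Contraction G 3 ] ExactlyCyclic M) → Deficient G 3
      from-triangle (M , ex) =
        [ (λ cycle → contradiction cycle not-cycle) , (λ (s , M , ch) → stage-deficient (reach s M ch)) ]′
          (cycle-or-chorded (order G) M (s≤s z≤n) ex (ℕ.m≤n+m _ 3))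

-- Cut vertices

⟪_⟫ : ∀ {N} {P : Fin N → Set} → (∀ v → Dec (P v)) → Subset N
⟪ P? ⟫ = tabulate (λ v → does (P? v))

module _ {N} {P : Fin N → Set} (P? : ∀ v → Dec (P v)) where

  ∈-⟪⟫⁺ : ∀ {v} → P v → v ∈ ⟪ P? ⟫
  ∈-⟪⟫⁺ {v} p = V.lookup⇒[]= v ⟪ P? ⟫ (trans (V.lookup∘tabulate (λ v → does (P? v)) v) (dec-true (P? v) p))

  ∈-⟪⟫⁻ : ∀ {v} → v ∈ ⟪ P? ⟫ → P v
  ∈-⟪⟫⁻ {v} v∈ with P? v | trans (sym (V.lookup∘tabulate (λ v → does (P? v)) v)) (V.[]=⇒lookup v∈)
  ... | yes p | _ = p
  ... | no _ | ()

module _ {N : ℕ} (G : Graph N) where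

  avoiding? : ∀ x u v → Dec (AdjAvoiding G x u v)
  avoiding? x u v = T? (adj G u v) ×-dec (¬? (u F.≟ x) ×-dec ¬? (v F.≟ x))

  avoiding-sym : ∀ {x u v} → AdjAvoiding G x u v → AdjAvoiding G x v u
  avoiding-sym (e , u≢x , v≢x) = adj-sym G e , v≢x , u≢x

  -- For a connected graph this amounts to a cut vertex, in a form that a finite search decides.
  CutPair : Set
  CutPair = ∃[ x ] ∃[ u ] ∃[ v ] (x ∈ V G × u ∈ V G × v ∈ V G × u ≢ x × v ≢ x × ¬ Star (AdjAvoiding G x) u v)

  cutPair? : Dec CutPair
  cutPair? = F.any? λ x → F.any? λ u → F.any? λ v →
    x S.∈? V G ×-dec (u S.∈? V G ×-dec (v S.∈? V G ×-dec (¬? (u F.≟ x) ×-dec (¬? (v F.≟ x) ×-dec ¬? (star? (avoiding? x) u v)))))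

  no-cutPair⇒NoCut : Connected G → ¬ CutPair → NoCut G
  no-cutPair⇒NoCut (_ , connected) none x {u} {v} u∈ v∈ u≢x v≢x with x S.∈? V G | star? (avoiding? x) u v
  ... | _ | yes walk = walk
  ... | yes x∈ | no ¬walk = contradiction (x , u , v , x∈ , u∈ , v∈ , u≢x , v≢x , ¬walk) none
  ... | no x∉ | no _ = Star.map (λ e → e , (λ { refl → x∉ (adj-V G e) }) , (λ { refl → x∉ (adj-V′ G e) })) (connected u∈ v∈)

  NoCut⇒no-cut-vertex : NoCut G → ∀ x → ¬ IsCutVertex G x
  NoCut⇒no-cut-vertex nocut x (_ , _ , _ , u∈ , u≢x , v∈ , v≢x , _ , ¬walk) = ¬walk (nocut x u∈ v∈ u≢x v≢x)

  within : Subset N → Fin N → Fin N → Bool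
  within p u v = adj G u v ∧ (⌊ u S.∈? p ⌋ ∧ ⌊ v S.∈? p ⌋)

  module _ {p : Subset N} where

    induced⁻ : ∀ {u v} → T (within p u v) → Adj G u v × u ∈ p × v ∈ p
    induced⁻ {u} {v} t =
      let (e , t′) = ∧⁻ {adj G u v} t
          (u∈ , v∈) = ∧⁻ {⌊ u S.∈? p ⌋} t′
      in e , toWitness {a? = u S.∈? p} u∈ , toWitness {a? = v S.∈? p} v∈

    induced⁺ : ∀ {u v} → Adj G u v → u ∈ p → v ∈ p → T (within p u v)
    induced⁺ {u} {v} e u∈ v∈ = Equivalence.from (T-∧ {adj G u v}) (e , Equivalence.from (T-∧ {⌊ u S.∈? p ⌋})
      (fromWitness {a? = u S.∈? p} u∈ , fromWitness {a? = v S.∈? p} v∈))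

  induced : Subset N → Graph N
  induced p = record
    { V = p
    ; adj = within p
    ; adj-sym = λ e → let (e , u∈ , v∈) = induced⁻ e in induced⁺ (adj-sym G e) v∈ u∈
    ; adj-irrefl = λ e → adj-irrefl G (proj₁ (induced⁻ e))
    ; adj-V = λ e → proj₁ (proj₂ (induced⁻ e)) }

  module _ {p : Subset N} where

    ⊑-induced : ∀ {X} → X ⊑ G → V X ⊆ p → X ⊑ induced p
    ⊑-induced {X} X⊑G X⊆p = record
      { V-⊆ = X⊆p ; Adj-⊆ = λ e → induced⁺ (Adj-⊆ X⊑G e) (X⊆p (adj-V X e)) (X⊆p (adj-V′ X e)) }

    block-induced : ∀ {X} → p ⊆ V G → IsBlock G X → V X ⊆ p → IsBlock (induced p) X
    block-induced p⊆ (X⊑G , X-ok , X-max) X⊆p = ⊑-induced X⊑G X⊆p , X-ok , λ Y Y⊑ Y-ok X⊑Y →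
      X-max Y (record { V-⊆ = p⊆ ∘ V-⊆ Y⊑ ; Adj-⊆ = λ e → proj₁ (induced⁻ (Adj-⊆ Y⊑ e)) }) Y-ok X⊑Y

  -- Closure makes `P` a union of components of G - x, so a walk from `P` to `x` stays in `P` until
  -- it arrives. Both a component and its complement have this property.
  module Side (connected : Connected G) (x : Fin N) (x∈ : x ∈ V G) {P : Fin N → Set} (P? : ∀ v → Dec (P v))
              (closed : ∀ {u v} → P u → AdjAvoiding G x u v → P v) where

    InSide : Fin N → Set
    InSide v = v ∈ V G × (v ≡ x ⊎ P v)

    inSide? : ∀ v → Dec (InSide v)
    inSide? v = v S.∈? V G ×-dec ((v F.≟ x) ⊎-dec P? v)

    side : Subset N
    side = ⟪ inSide? ⟫

    side⁺ : ∀ {v} → v ∈ V G → v ≡ x ⊎ P v → v ∈ side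
    side⁺ v∈ p = ∈-⟪⟫⁺ inSide? (v∈ , p)

    side⁻ : ∀ {v} → v ∈ side → InSide v
    side⁻ = ∈-⟪⟫⁻ inSide?

    side⊆ : side ⊆ V G
    side⊆ v∈ = proj₁ (side⁻ v∈)

    x∈side : x ∈ side
    x∈side = side⁺ x∈ (inj₁ refl)

    to-x : ∀ {v} → Star (Adj G) v x → v ≢ x → P v → Star (Adj (induced side)) v x
    to-x ε v≢x p = contradiction refl v≢x
    to-x {v} (_◅_ {_} {y} e walk) v≢x p with y F.≟ x
    ... | yes refl = induced⁺ e (side⁺ (adj-V G e) (inj₂ p)) x∈side ◅ ε
    ... | no y≢x = induced⁺ e (side⁺ (adj-V G e) (inj₂ p)) (side⁺ (adj-V′ G e) (inj₂ q)) ◅ to-x walk y≢x q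
      where q = closed p (e , v≢x , y≢x)

    reach-x : ∀ {v} → v ∈ side → Star (Adj (induced side)) v x
    reach-x {v} v∈ with v F.≟ x | side⁻ v∈
    ... | yes refl | _ = ε
    ... | no v≢x | _ , inj₁ v≡x = contradiction v≡x v≢x
    ... | no v≢x | v∈G , inj₂ p = to-x (proj₂ connected v∈G x∈) v≢x p

    side-connected : Connected (induced side)
    side-connected = (x , x∈side) , λ u∈ v∈ → reach-x u∈ ◅◅ reverse (adj-sym (induced side)) (reach-x v∈)

  -- The colours of the second side are shifted by `k₁`, so picks from both sides combine. On each
  -- side the terminals lying outside it are replaced by `x`; terminals on different sides are then
  -- linked through `x`.
  module Glue {p₁ p₂ : Subset N} {x : Fin N} (cover : ∀ {v} → v ∈ V G → v ∈ p₁ ⊎ v ∈ p₂)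
              (meet : ∀ {v} → v ∈ p₁ → v ∈ p₂ → v ≡ x) (x∈₁ : x ∈ p₁) (x∈₂ : x ∈ p₂)
              {k₁ k₂} (rb₁ : Rainbow₃ (_∈ p₁) (Adj (induced p₁)) k₁) (rb₂ : Rainbow₃ (_∈ p₂) (Adj (induced p₂)) k₂) where

    private
      module R₁ = Rainbow₃ rb₁
      module R₂ = Rainbow₃ rb₂

      Both₁? : ∀ u v → Dec (u ∈ p₁ × v ∈ p₁)
      Both₁? u v = u S.∈? p₁ ×-dec v S.∈? p₁

      γ : Fin N → Fin N → ℕ
      γ u v with Both₁? u v
      ... | yes _ = R₁.γ u v
      ... | no _ = k₁ + R₂.γ u v

      γ₁ : ∀ {u v} → u ∈ p₁ × v ∈ p₁ → γ u v ≡ R₁.γ u v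
      γ₁ {u} {v} both with Both₁? u v
      ... | yes _ = refl
      ... | no ¬both = contradiction both ¬both

      γ₂ : ∀ {u v} → ¬ (u ∈ p₁ × v ∈ p₁) → γ u v ≡ k₁ + R₂.γ u v
      γ₂ {u} {v} ¬both with Both₁? u v
      ... | yes both = contradiction both ¬both
      ... | no _ = refl

      γ-sym : ∀ u v → γ u v ≡ γ v u
      γ-sym u v with Both₁? u v
      ... | yes both = trans (R₁.γ-sym u v) (sym (γ₁ (swap both)))
      ... | no ¬both = trans (cong (k₁ +_) (R₂.γ-sym u v)) (sym (γ₂ (¬both ∘ swap)))

      to₁ : Fin N → Fin N
      to₁ v with v S.∈? p₁
      ... | yes _ = v
      ... | no _ = x

      to₁∈ : ∀ v → to₁ v ∈ p₁
      to₁∈ v with v S.∈? p₁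
      ... | yes v∈ = v∈
      ... | no _ = x∈₁

      to₂ : Fin N → Fin N
      to₂ v with v S.∈? p₂
      ... | yes _ = v
      ... | no _ = x

      to₂∈ : ∀ v → to₂ v ∈ p₂
      to₂∈ v with v S.∈? p₂
      ... | yes v∈ = v∈
      ... | no _ = x∈₂

    module _ (pick₁ pick₂ : ℕ → Fin N × Fin N) where

      pick : ℕ → Fin N × Fin N
      pick c with c <? k₁
      ... | yes _ = pick₁ c
      ... | no _ = pick₂ (c ∸ k₁)

      pick-< : ∀ {c} → c < k₁ → pick c ≡ pick₁ c
      pick-< {c} c<k with c <? k₁
      ... | yes _ = refl
      ... | no c≮k = contradiction c<k c≮k

      pick-+ : ∀ c → pick (k₁ + c) ≡ pick₂ c
      pick-+ c with k₁ + c <? k₁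
      ... | yes <k = contradiction <k (ℕ.≤⇒≯ (ℕ.m≤m+n k₁ c))
      ... | no _ = cong pick₂ (ℕ.m+n∸m≡n k₁ c)

      step₁ : ∀ {u v} → Picked (Adj (induced p₁)) R₁.γ k₁ pick₁ u v → Picked (Adj G) γ (k₁ + k₂) pick u v
      step₁ (e , <k , eq) with induced⁻ {p = p₁} e
      ... | e′ , both rewrite γ₁ both | pick-< <k = e′ , ℕ.<-≤-trans <k (ℕ.m≤m+n k₁ k₂) , eq

      step₂ : ∀ {u v} → Picked (Adj (induced p₂)) R₂.γ k₂ pick₂ u v → Picked (Adj G) γ (k₁ + k₂) pick u v
      step₂ {u} {v} (e , <k , eq) with induced⁻ {p = p₂} e
      -- An edge with both ends on both sides would be a loop at `x`.
      ... | e′ , u∈₂ , v∈₂ rewrite γ₂ {u} {v} (λ (u∈₁ , v∈₁) →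
                adj-irrefl G (subst₂ (Adj G) (meet u∈₁ u∈₂) (meet v∈₁ v∈₂) e′)) | pick-+ (R₂.γ u v) =
        e′ , ℕ.+-monoʳ-< k₁ <k , eq

      module _ {u v} (walk₁ : Star (Picked (Adj (induced p₁)) R₁.γ k₁ pick₁) (to₁ u) (to₁ v))
                     (walk₂ : Star (Picked (Adj (induced p₂)) R₂.γ k₂ pick₂) (to₂ u) (to₂ v)) where

        walk : u ∈ V G → v ∈ V G → Star (Picked (Adj G) γ (k₁ + k₂) pick) u v
        walk u∈ v∈ with u S.∈? p₁ | v S.∈? p₁ | u S.∈? p₂ | v S.∈? p₂ | Star.map step₁ walk₁ | Star.map step₂ walk₂
        ... | yes _ | yes _ | _ | _ | w₁ | _ = w₁
        ... | _ | _ | yes _ | yes _ | _ | w₂ = w₂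
        ... | yes _ | no _ | no _ | yes _ | w₁ | w₂ = w₁ ◅◅ w₂
        ... | no _ | yes _ | yes _ | no _ | w₁ | w₂ = w₂ ◅◅ w₁
        ... | no u∉₁ | _ | no u∉₂ | _ | _ | _ = ⊥-elim ([ u∉₁ , u∉₂ ]′ (cover u∈))
        ... | _ | no v∉₁ | _ | no v∉₂ | _ | _ = ⊥-elim ([ v∉₁ , v∉₂ ]′ (cover v∈))

    glued : Rainbow₃ (_∈ V G) (Adj G) (k₁ + k₂)
    glued = record
      { γ = γ ; γ-sym = γ-sym
      ; join = λ s s∈ →
          let (pick₁ , walk₁) = R₁.join (to₁ ∘ s) (to₁∈ ∘ s)
              (pick₂ , walk₂) = R₂.join (to₂ ∘ s) (to₂∈ ∘ s)
          in pick pick₁ pick₂ , λ i j → walk pick₁ pick₂ (walk₁ i j) (walk₂ i j) (s∈ i) (s∈ j) }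

module _ {N : ℕ} {X Y : Graph N} where

  order-≤ : X ⊑ Y → order X ≤ order Y
  order-≤ X⊑Y = S.p⊆q⇒∣p∣≤∣q∣ (V-⊆ X⊑Y)

  IsCycle-≈ : X ≈ Y → IsCycle X → IsCycle Y
  IsCycle-≈ (X⊑Y , Y⊑X) (m , 3≤m , c , c-inj , c-V , c-adj) = m , 3≤m , c , c-inj ,
    (λ v → mk⇔ (Equivalence.to (c-V v) ∘ V-⊆ Y⊑X) (V-⊆ X⊑Y ∘ Equivalence.from (c-V v))) ,
    (λ i j → mk⇔ (Equivalence.to (c-adj i j) ∘ Adj-⊆ Y⊑X) (Adj-⊆ X⊑Y ∘ Equivalence.from (c-adj i j)))

-- Compared with the order X − 1 colours of a spanning tree.
data Saves {N} (X : Graph N) : ℕ → Set where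
  saves-0 : Saves X 0
  saves-1 : 4 ≤ order X → Saves X 1
  saves-2 : ¬ IsCycle X → 7 ≤ order X → Saves X 2

saves-deficient : ∀ {N} {G X : Graph N} {w} → Connected G → NoCut G → X ≈ G → Saves X w → Deficient G (suc w)
saves-deficient {G = G} connected nocut (X⊑G , G⊑X) saves-0 = deficient₁ G connected nocut
saves-deficient {G = G} connected nocut (X⊑G , G⊑X) (saves-1 4≤) = deficient₂ G connected nocut (ℕ.≤-trans 4≤ (order-≤ X⊑G))
saves-deficient {G = G} connected nocut (X⊑G , G⊑X) (saves-2 ¬cycle 7≤) =
  deficient₃ G connected nocut (ℕ.≤-trans 7≤ (order-≤ X⊑G)) (¬cycle ∘ IsCycle-≈ (G⊑X , X⊑G))

sum-filter : ∀ {A : Set} (w : A → ℕ) {P : A → Set} (P? : ∀ x → Dec (P x)) xs →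
             sum (map w (filter P? xs)) + sum (map w (filter (¬? ∘ P?) xs)) ≡ sum (map w xs)
sum-filter w P? [] = refl
sum-filter w P? (x ∷ xs) with P? x
... | yes _ = trans (ℕ.+-assoc (w x) _ _) (cong (w x +_) (sum-filter w P? xs))
... | no _ = trans (sym (ℕ.+-assoc a (w x) b)) (trans (cong (_+ b) (ℕ.+-comm a (w x)))
               (trans (ℕ.+-assoc (w x) a b) (cong (w x +_) (sum-filter w P? xs))))
  where
  a = sum (map w (filter P? xs))
  b = sum (map w (filter (¬? ∘ P?) xs))

module _ {N : ℕ} {G : Graph N} where

  -- x separates a block that has vertices on both sides.
  block-sides : ∀ {X x} {P : Fin N → Set} (connected : Connected G) (x∈ : x ∈ V G) (P? : ∀ v → Dec (P v)) →
    (closed : ∀ {u v} → P u → AdjAvoiding G x u v → P v) (closed′ : ∀ {u v} → ¬ P u → AdjAvoiding G x u v → ¬ P v) →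
    X ⊑ G → ConnectedWithoutCutVertex X →
    ¬ V X ⊆ Side.side G connected x x∈ P? closed → V X ⊆ Side.side G connected x x∈ (¬? ∘ P?) closed′
  block-sides {X} {x} {P} connected x∈ P? closed closed′ X⊑G ((_ , X-conn) , X-nocut) X⊈ {z} z∈ =
    S₂.side⁺ closed′ (V-⊆ X⊑G z∈) (outside-P (F.any? λ y → y S.∈? V X ×-dec (¬? (y F.≟ x) ×-dec ¬? (P? y))))
    where
    module S₁ = Side G connected x x∈ P?
    module S₂ = Side G connected x x∈ (¬? ∘ P?)
    follow : ∀ {u v} → Star (AdjAvoiding X x) u v → P u → P v
    follow ε p = p
    follow ((e , u≢x , v≢x) ◅ walk) p = follow walk (closed p (Adj-⊆ X⊑G e , u≢x , v≢x))
    avoid : x ∉ V X → ∀ {u v} → Star (Adj X) u v → Star (AdjAvoiding X x) u v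
    avoid x∉ = Star.map λ e → e , (λ { refl → x∉ (adj-V X e) }) , (λ { refl → x∉ (adj-V′ X e) })
    outside-P : Dec (∃[ y ] (y ∈ V X × y ≢ x × ¬ P y)) → z ≡ x ⊎ ¬ P z
    outside-P (no all-P) = ⊥-elim (X⊈ λ {y} y∈ → S₁.side⁺ closed (V-⊆ X⊑G y∈) (x-or-P y y∈))
      where
      x-or-P : ∀ y → y ∈ V X → y ≡ x ⊎ P y
      x-or-P y y∈ with y F.≟ x | P? y
      ... | yes y≡x | _ = inj₁ y≡x
      ... | no _ | yes p = inj₂ p
      ... | no y≢x | no ¬p = contradiction (y , y∈ , y≢x , ¬p) all-P
    outside-P (yes (y , y∈ , y≢x , ¬Py)) with z F.≟ x
    ... | yes z≡x = inj₁ z≡x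
    ... | no z≢x = inj₂ λ Pz → case x S.∈? V X of λ where
            (no x∉) → ¬Py (follow (avoid x∉ (X-conn z∈ y∈)) Pz)
            (yes x∈X) → X-nocut x (x∈X , z , y , z∈ , z≢x , y∈ , y≢x , X-conn z∈ y∈ , λ walk → ¬Py (follow walk Pz))

  -- The sides share one vertex, so their orders add up to the order of `G` plus 1. That vertex pays
  -- for one of the two spanning tree units, and the savings `d₁` and `d₂` add up in full.
  glue-deficient : ∀ {p₁ p₂ x d₁ d₂} → (∀ {v} → v ∈ V G → v ∈ p₁ ⊎ v ∈ p₂) → (∀ {v} → v ∈ p₁ → v ∈ p₂ → v ≡ x) →
    p₁ ⊆ V G → p₂ ⊆ V G → x ∈ p₁ → x ∈ p₂ →
    Deficient (induced G p₁) (suc d₁) → Deficient (induced G p₂) (suc d₂) → Deficient G (suc (d₁ + d₂))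
  glue-deficient {p₁} {p₂} {x} {d₁} {d₂} cover meet p₁⊆ p₂⊆ x∈₁ x∈₂
                 (deficient {k₁} rb₁ bound₁) (deficient {k₂} rb₂ bound₂) =
    deficient (Glue.glued G cover meet x∈₁ x∈₂ rb₁ rb₂) (ℕ.≤-pred (begin
      suc (k₁ + k₂ + suc (d₁ + d₂))     ≡⟨ rearrange k₁ k₂ d₁ d₂ ⟩
      (k₁ + suc d₁) + (k₂ + suc d₂)     ≤⟨ ℕ.+-mono-≤ bound₁ bound₂ ⟩
      ∣ p₁ ∣ + ∣ p₂ ∣                   ≡⟨ sym (∣p∪q∣+∣p∩q∣ p₁ p₂) ⟩
      ∣ p₁ ∪ p₂ ∣ + ∣ p₁ ∩ p₂ ∣         ≤⟨ ℕ.+-mono-≤ (S.p⊆q⇒∣p∣≤∣q∣ (λ v∈ → [ p₁⊆ , p₂⊆ ]′ (S.x∈p∪q⁻ p₁ p₂ v∈)))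
                                                      (S.p⊆q⇒∣p∣≤∣q∣ ∩⊆) ⟩
      order G + ∣ ⁅ x ⁆ ∣               ≡⟨ cong (order G +_) (S.∣⁅x⁆∣≡1 x) ⟩
      order G + 1                       ≡⟨ ℕ.+-comm (order G) 1 ⟩
      suc (order G)                     ∎))
    where
    open ℕ.≤-Reasoning
    ∩⊆ : p₁ ∩ p₂ ⊆ ⁅ x ⁆
    ∩⊆ v∈ = let (v∈₁ , v∈₂) = S.x∈p∩q⁻ p₁ p₂ v∈ in subst (_∈ ⁅ x ⁆) (sym (meet v∈₁ v∈₂)) (S.x∈⁅x⁆ x)
    rearrange : ∀ a b c d → suc (a + b + suc (c + d)) ≡ (a + suc c) + (b + suc d)
    rearrange = solve-∀

module Blocks {N q : ℕ} (B : Fin q → Graph N) (distinct : ∀ {i j} → B i ≈ B j → i ≡ j)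
              (w : Fin q → ℕ) (saves : ∀ i → Saves (B i) (w i)) where

  weight : List (Fin q) → ℕ
  weight is = sum (map w is)

  whole-block : ∀ {G : Graph N} {X} → Connected G → NoCut G → IsBlock G X → X ≈ G
  whole-block {G} connected nocut (X⊑G , _ , maximal) =
    X⊑G , maximal G (record { V-⊆ = id ; Adj-⊆ = id }) (connected , NoCut⇒no-cut-vertex G nocut) X⊑G

  -- By maximality a block of `G` is all of `G`, so a list of distinct blocks has at most one entry.
  nocut-deficient : ∀ {G} → Connected G → NoCut G → ∀ is → Unique is → All (IsBlock G ∘ B) is → Deficient G (suc (weight is))
  nocut-deficient {G} connected nocut [] _ _ = deficient₁ G connected nocut
  nocut-deficient connected nocut (i ∷ []) _ (b ∷ []) = subst (λ w → Deficient _ (suc w)) (sym (ℕ.+-identityʳ (w i)))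
    (saves-deficient connected nocut (whole-block connected nocut b) (saves i))
  nocut-deficient connected nocut (i ∷ j ∷ _) ((i≢j ∷ _) ∷ _) (b ∷ b′ ∷ _) =
    let (Bi⊑G , G⊑Bi) = whole-block connected nocut b
        (Bj⊑G , G⊑Bj) = whole-block connected nocut b′
    in contradiction (distinct (⊑-trans Bi⊑G G⊑Bj , ⊑-trans Bj⊑G G⊑Bi)) i≢j
    where
    ⊑-trans : ∀ {X Y Z : Graph N} → X ⊑ Y → Y ⊑ Z → X ⊑ Z
    ⊑-trans X⊑Y Y⊑Z = record { V-⊆ = V-⊆ Y⊑Z ∘ V-⊆ X⊑Y ; Adj-⊆ = Adj-⊆ Y⊑Z ∘ Adj-⊆ X⊑Y }

  -- Induction on the order: each side of a cut vertex misses a vertex of the other. Every listed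
  -- block lies within one side and is still a block there, so the weights of the two filtered lists
  -- add up to the total.
  blocks-deficient : ∀ n {G} → order G ≤ n → Connected G → ∀ is → Unique is → All (IsBlock G ∘ B) is → Deficient G (suc (weight is))
  cut-deficient : ∀ n {G} → order G ≤ suc n → Connected G → CutPair G → ∀ is → Unique is → All (IsBlock G ∘ B) is → Deficient G (suc (weight is))

  blocks-deficient zero {G} n≤0 ((v , v∈) , _) = contradiction (ℕ.≤-trans (S.p⊆q⇒∣p∣≤∣q∣ ⁅v⁆⊆) n≤0)
    (subst (λ k → ¬ k ≤ 0) (sym (S.∣⁅x⁆∣≡1 v)) λ ())
    where
    ⁅v⁆⊆ : ⁅ v ⁆ ⊆ V G
    ⁅v⁆⊆ u∈ = subst (_∈ V G) (sym (S.x∈⁅y⁆⇒x≡y v u∈)) v∈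
  blocks-deficient (suc n) {G} n≤ connected is u bs =
    [ (λ cut → cut-deficient n n≤ connected cut is u bs) ,
      (λ ¬cut → nocut-deficient connected (no-cutPair⇒NoCut G connected ¬cut) is u bs) ]′ (toSum (cutPair? G))

  cut-deficient n {G} n≤ connected (x , u , v , x∈ , u∈ , v∈ , u≢x , v≢x , ¬walk) is uniq bs =
    subst (λ w → Deficient G (suc w)) (sum-filter w in₁? is)
      (glue-deficient cover meet S₁.side⊆ S₂.side⊆ S₁.x∈side S₂.x∈side
        (blocks-deficient n (smaller S₁.side⊆ v∈ v∉₁) S₁.side-connected (filter in₁? is) (Unique.filter⁺ in₁? uniq)
          (All.map (λ (b , X⊆) → block-induced G S₁.side⊆ b X⊆) (All.zip (All.filter⁺ in₁? bs , All.all-filter in₁? is))))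
        (blocks-deficient n (smaller S₂.side⊆ u∈ u∉₂) S₂.side-connected (filter (¬? ∘ in₁?) is) (Unique.filter⁺ (¬? ∘ in₁?) uniq)
          (All.map (λ (b , X⊈) → block-induced G S₂.side⊆ b (block-sides connected x∈ near? closed closed′ (proj₁ b) (proj₁ (proj₂ b)) X⊈))
            (All.zip (All.filter⁺ (¬? ∘ in₁?) bs , All.all-filter (¬? ∘ in₁?) is)))))
    where
    Near : Fin N → Set
    Near = Star (AdjAvoiding G x) u
    near? : ∀ v → Dec (Near v)
    near? = star? (avoiding? G x) u
    closed : ∀ {a b} → Near a → AdjAvoiding G x a b → Near b
    closed near e = near ◅◅ e ◅ ε
    closed′ : ∀ {a b} → ¬ Near a → AdjAvoiding G x a b → ¬ Near b
    closed′ far e near = far (closed near (avoiding-sym G e))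
    module S₁ = Side G connected x x∈ near? closed
    module S₂ = Side G connected x x∈ (¬? ∘ near?) closed′
    in₁? : ∀ i → Dec (V (B i) ⊆ S₁.side)
    in₁? i = V (B i) S.⊆? S₁.side
    cover : ∀ {z} → z ∈ V G → z ∈ S₁.side ⊎ z ∈ S₂.side
    cover {z} z∈ with near? z
    ... | yes near = inj₁ (S₁.side⁺ z∈ (inj₂ near))
    ... | no far = inj₂ (S₂.side⁺ z∈ (inj₂ far))
    meet : ∀ {z} → z ∈ S₁.side → z ∈ S₂.side → z ≡ x
    meet z∈₁ z∈₂ with S₁.side⁻ z∈₁ | S₂.side⁻ z∈₂
    ... | _ , inj₁ z≡x | _ = z≡x
    ... | _ | _ , inj₁ z≡x = z≡x
    ... | _ , inj₂ near | _ , inj₂ far = contradiction near far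
    v∉₁ : v ∉ S₁.side
    v∉₁ v∈₁ = [ v≢x , ¬walk ]′ (proj₂ (S₁.side⁻ v∈₁))
    u∉₂ : u ∉ S₂.side
    u∉₂ u∈₂ = [ u≢x , (λ far → far ε) ]′ (proj₂ (S₂.side⁻ u∈₂))
    smaller : ∀ {p y} → p ⊆ V G → y ∈ V G → y ∉ p → ∣ p ∣ ≤ n
    smaller p⊆ y∈ y∉ = ℕ.≤-pred (ℕ.<-≤-trans (S.p⊂q⇒∣p∣<∣q∣ (p⊆ , _ , y∈ , y∉)) n≤)

-- Trees

module _ {N : ℕ} where

  Next-asym : ∀ {m} {i j : Fin m} → 3 ≤ m → Next {N} i j → ¬ Next {N} j i
  Next-asym 3≤m (inj₁ p) (inj₁ q) = ℕ.<-asym (ℕ.≤-reflexive p) (ℕ.≤-reflexive q)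
  Next-asym 3≤m (inj₁ p) (inj₂ (q , r)) =
    ℕ.<⇒≢ 3≤m (trans (cong suc (trans (cong suc (sym r)) p)) q)
  Next-asym 3≤m (inj₂ (p , q)) (inj₁ r) =
    ℕ.<⇒≢ 3≤m (trans (cong suc (trans (cong suc (sym q)) r)) p)
  Next-asym 3≤m (inj₂ (p , q)) (inj₂ (_ , r)) =
    ℕ.<⇒≢ (ℕ.<-trans (ℕ.n<1+n 1) 3≤m) (trans (cong suc (sym r)) p)

  next : ∀ {m} (i : Fin m) → ∃[ j ] Next {N} i j
  next {suc m} i with suc (toℕ i) <? suc m
  ... | yes i<m = fromℕ< i<m , inj₁ (sym (F.toℕ-fromℕ< i<m))
  ... | no i≮m = zero , inj₂ (ℕ.≤-antisym (F.toℕ<n i) (ℕ.≮⇒≥ i≮m) , refl)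

  previous : ∀ {m} (i : Fin m) → ∃[ j ] Next {N} j i
  previous {suc m} zero = opposite zero , inj₂ (cong suc (F.opposite-prop zero) , refl)
  previous {suc m} (suc i) = inject₁ i , inj₁ (cong suc (F.toℕ-inject₁ i))

  cycle-neighbours : ∀ (C : Graph N) {v} → IsCycle C → v ∈ V C → ∃[ x ] ∃[ y ] (x ≢ y × Adj C v x × Adj C v y)
  cycle-neighbours C (m , 3≤m , c , c-inj , c-V , c-adj) v∈ with Equivalence.to (c-V _) v∈
  ... | i , refl =
    let (j , n) = next i
        (k , p) = previous i
    in c j , c k , (λ eq → Next-asym 3≤m n (subst (λ k → Next {N} k i) (sym (c-inj eq)) p)) ,
       Equivalence.from (c-adj i j) (inj₁ n) , Equivalence.from (c-adj i k) (inj₂ p)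

  cycle-vertex : ∀ (C : Graph N) → IsCycle C → Nonempty (V C)
  cycle-vertex C (suc m , _ , c , _ , c-V , _) = c zero , Equivalence.from (c-V (c zero)) (zero , refl)

  vertex : Fin N → Graph N
  vertex v = record { V = ⁅ v ⁆ ; adj = λ _ _ → false ; adj-sym = λ () ; adj-irrefl = λ () ; adj-V = λ () }

  vertex-tree : ∀ v → IsTree (vertex v)
  vertex-tree v = ((v , S.x∈⁅x⁆ v) , λ a∈ b∈ → subst (Star _ _) (trans (S.x∈⁅y⁆⇒x≡y v a∈) (sym (S.x∈⁅y⁆⇒x≡y v b∈))) ε) ,
    λ C C⊑ cycle → let (_ , _ , _ , e , _) = cycle-neighbours C cycle (proj₂ (cycle-vertex C cycle)) in Adj-⊆ C⊑ e

  module Leaf (H : Graph N) {u v : Fin N} (u∈ : u ∈ V H) (v∉ : v ∉ V H) where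

    New : Fin N → Fin N → Set
    New a b = (a ≡ u × b ≡ v) ⊎ (a ≡ v × b ≡ u)

    leaf? : ∀ a b → Dec (Adj H a b ⊎ New a b)
    leaf? a b = T? (adj H a b) ⊎-dec ((a F.≟ u ×-dec b F.≟ v) ⊎-dec (a F.≟ v ×-dec b F.≟ u))

    withLeaf : Graph N
    withLeaf = record
      { V = V H ∪ ⁅ v ⁆
      ; adj = λ a b → ⌊ leaf? a b ⌋
      ; adj-sym = λ {a} {b} e → fromWitness {a? = leaf? b a} (flip-edge (toWitness {a? = leaf? a b} e))
      ; adj-irrefl = λ {a} e → loop (toWitness {a? = leaf? a a} e)
      ; adj-V = λ {a} {b} e → end (toWitness {a? = leaf? a b} e) }
      where
      flip-edge : ∀ {a b} → Adj H a b ⊎ New a b → Adj H b a ⊎ New b a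
      flip-edge (inj₁ e) = inj₁ (adj-sym H e)
      flip-edge (inj₂ (inj₁ (p , q))) = inj₂ (inj₂ (q , p))
      flip-edge (inj₂ (inj₂ (p , q))) = inj₂ (inj₁ (q , p))
      loop : ∀ {a} → ¬ (Adj H a a ⊎ New a a)
      loop (inj₁ e) = adj-irrefl H e
      loop (inj₂ (inj₁ (refl , refl))) = v∉ u∈
      loop (inj₂ (inj₂ (refl , refl))) = v∉ u∈
      end : ∀ {a b} → Adj H a b ⊎ New a b → a ∈ V H ∪ ⁅ v ⁆
      end (inj₁ e) = S.x∈p∪q⁺ (inj₁ (adj-V H e))
      end (inj₂ (inj₁ (refl , _))) = S.x∈p∪q⁺ (inj₁ u∈)
      end (inj₂ (inj₂ (refl , _))) = S.x∈p∪q⁺ (inj₂ (S.x∈⁅x⁆ v))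

    leaf⁻ : ∀ {a b} → Adj withLeaf a b → Adj H a b ⊎ New a b
    leaf⁻ {a} {b} = toWitness {a? = leaf? a b}

    leaf⁺ : ∀ {a b} → Adj H a b ⊎ New a b → Adj withLeaf a b
    leaf⁺ {a} {b} = fromWitness {a? = leaf? a b}

    leaf-neighbour : ∀ {b} → Adj withLeaf v b → b ≡ u
    leaf-neighbour e with leaf⁻ e
    ... | inj₁ e′ = contradiction (adj-V H e′) v∉
    ... | inj₂ (inj₁ (refl , refl)) = refl
    ... | inj₂ (inj₂ (_ , b≡u)) = b≡u

    -- A cycle through `v` would give `v` two distinct neighbours, but `u` is its only one; a cycle
    -- that misses `v` lies in `H`.
    leaf-tree : IsTree H → IsTree withLeaf
    leaf-tree ((_ , connected) , acyclic) =
      ((u , S.x∈p∪q⁺ (inj₁ u∈)) , λ a∈ b∈ → reverse (adj-sym withLeaf) (from-u a∈) ◅◅ from-u b∈) , acyclic′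
      where
      from-u : ∀ {a} → a ∈ V withLeaf → Star (Adj withLeaf) u a
      from-u a∈ with S.x∈p∪q⁻ (V H) ⁅ v ⁆ a∈
      ... | inj₁ a∈H = Star.map (leaf⁺ ∘ inj₁) (connected u∈ a∈H)
      ... | inj₂ a∈v rewrite S.x∈⁅y⁆⇒x≡y v a∈v = leaf⁺ (inj₂ (inj₁ (refl , refl))) ◅ ε
      acyclic′ : ∀ C → C ⊑ withLeaf → ¬ IsCycle C
      acyclic′ C C⊑ cycle with v S.∈? V C
      ... | yes v∈ = let (x , y , x≢y , e , f) = cycle-neighbours C cycle v∈ in
                     x≢y (trans (leaf-neighbour (Adj-⊆ C⊑ e)) (sym (leaf-neighbour (Adj-⊆ C⊑ f))))
      ... | no v∉C = acyclic C (record { V-⊆ = old-vertex ; Adj-⊆ = old-edge }) cycle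
        where
        old-vertex : V C ⊆ V H
        old-vertex a∈ with S.x∈p∪q⁻ (V H) ⁅ v ⁆ (V-⊆ C⊑ a∈)
        ... | inj₁ a∈H = a∈H
        ... | inj₂ a∈v = contradiction (subst (_∈ V C) (S.x∈⁅y⁆⇒x≡y v a∈v) a∈) v∉C
        old-edge : ∀ {a b} → Adj C a b → Adj H a b
        old-edge e with leaf⁻ (Adj-⊆ C⊑ e)
        ... | inj₁ e′ = e′
        ... | inj₂ (inj₁ (_ , refl)) = contradiction (adj-V′ C e) v∉C
        ... | inj₂ (inj₂ (refl , _)) = contradiction (adj-V C e) v∉C

  module _ {E : Fin N → Fin N → Set} (E-sym : ∀ {a b} → E a b → E b a) where

    record TreeWithin : Set where
      field
        H     : Graph N
        tree  : IsTree H
        edges : ∀ {a b} → Adj H a b → E a b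

    open TreeWithin

    -- The walk is followed step by step, and each vertex not yet in the tree is attached as a leaf
    -- to its predecessor. No cycle ever has to be removed.
    reach-tree : ∀ {a b} → Star E a b → (t : TreeWithin) → a ∈ V (H t) →
                 Σ[ t′ ∈ TreeWithin ] (V (H t) ⊆ V (H t′) × b ∈ V (H t′))
    reach-tree ε t a∈ = t , id , a∈
    reach-tree (_◅_ {a} {c} e walk) t a∈ with c S.∈? V (H t)
    ... | yes c∈ = reach-tree walk t c∈
    ... | no c∉ = let (t″ , ⊆″ , b∈) = reach-tree walk t′ (S.x∈p∪q⁺ (inj₂ (S.x∈⁅x⁆ c))) in
                  t″ , (λ x∈ → ⊆″ (S.x∈p∪q⁺ (inj₁ x∈))) , b∈
      where
      open Leaf (H t) a∈ c∉
      new-edge : ∀ {x y} → Adj (H t) x y ⊎ New x y → E x y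
      new-edge (inj₁ f) = edges t f
      new-edge (inj₂ (inj₁ (refl , refl))) = e
      new-edge (inj₂ (inj₂ (refl , refl))) = E-sym e
      t′ : TreeWithin
      t′ = record { H = withLeaf ; tree = leaf-tree (tree t) ; edges = new-edge ∘ leaf⁻ }

    tree-through : ∀ v m (r : Fin m → Fin N) → (∀ i → Star E v (r i)) →
                   Σ[ t ∈ TreeWithin ] (v ∈ V (H t) × (∀ i → r i ∈ V (H t)))
    tree-through v zero r _ = record { H = vertex v ; tree = vertex-tree v ; edges = λ () } , S.x∈⁅x⁆ v , λ ()
    tree-through v (suc m) r walks =
      let (t , v∈ , rest) = tree-through v m (r ∘ suc) (walks ∘ suc)
          (t′ , ⊆′ , r0∈) = reach-tree (walks zero) t v∈
      in t′ , ⊆′ v∈ , λ { zero → r0∈ ; (suc i) → ⊆′ (rest i) }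

-- Decidability of the rainbow index

⊆-extend : ∀ {N} (p q : Subset N) m → p ⊆ q → ∣ p ∣ ≤ m → m ≤ ∣ q ∣ → ∃[ r ] (p ⊆ r × r ⊆ q × ∣ r ∣ ≡ m)
⊆-extend [] [] zero p⊆q _ _ = [] , p⊆q , id , refl
⊆-extend (outside ∷ p) (outside ∷ q) m p⊆q p≤m m≤q =
  let (r , p⊆r , r⊆q , eq) = ⊆-extend p q m (S.drop-∷-⊆ p⊆q) p≤m m≤q in
  outside ∷ r , S.out⊆ p⊆r , S.out⊆ r⊆q , eq
⊆-extend (inside ∷ p) (outside ∷ q) m p⊆q _ _ with () ← p⊆q here
⊆-extend (inside ∷ p) (inside ∷ q) (suc m) p⊆q (s≤s p≤m) (s≤s m≤q) =
  let (r , p⊆r , r⊆q , eq) = ⊆-extend p q m (S.drop-∷-⊆ p⊆q) p≤m m≤q in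
  inside ∷ r , S.s⊆s p⊆r , S.s⊆s r⊆q , cong suc eq
⊆-extend (outside ∷ p) (inside ∷ q) m p⊆q p≤m m≤q with ℕ.m≤n⇒m<n∨m≡n m≤q
... | inj₂ m≡ = inside ∷ q , p⊆q , id , sym m≡
... | inj₁ (s≤s m≤q′) =
  let (r , p⊆r , r⊆q , eq) = ⊆-extend p q m (S.drop-∷-⊆ p⊆q) p≤m m≤q′ in
  outside ∷ r , S.out⊆ p⊆r , S.out⊆ r⊆q , eq

enumerate : ∀ {N} (p : Subset N) → Σ[ f ∈ (Fin ∣ p ∣ → Fin N) ] ((∀ i → f i ∈ p) × (∀ {v} → v ∈ p → ∃[ i ] f i ≡ v))
enumerate [] = (λ ()) , (λ ()) , λ ()
enumerate (outside ∷ p) =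
  let (f , f∈ , onto) = enumerate p in
  suc ∘ f , (λ i → there (f∈ i)) , λ { (there v∈) → let (i , eq) = onto v∈ in i , cong suc eq }
enumerate (inside ∷ p) =
  let (f , f∈ , onto) = enumerate p in
  (λ { zero → zero ; (suc i) → suc (f i) }) , (λ { zero → here ; (suc i) → there (f∈ i) }) ,
  λ { here → zero , refl ; (there v∈) → let (i , eq) = onto v∈ in suc i , cong suc eq }

-- Predicates are arbitrary and need not respect pointwise equality of functions; therefore
-- colourings and picks are searched as vectors.
Searchable : Set → Set₁
Searchable A = ∀ {P : A → Set} → (∀ x → Dec (P x)) → Dec (∃ P)

search-× : ∀ {A B} → Searchable A → Searchable B → Searchable (A × B)
search-× searchA searchB P? =
  map′ (λ (a , b , p) → (a , b) , p) (λ ((a , b) , p) → a , b , p) (searchA λ a → searchB λ b → P? (a , b))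

search-Vec : ∀ {A} → Searchable A → ∀ n → Searchable (Vec A n)
search-Vec searchA zero P? = map′ (λ p → [] , p) (λ { ([] , p) → p }) (P? [])
search-Vec searchA (suc n) P? =
  map′ (λ (x , xs , p) → x ∷ xs , p) (λ { (x ∷ xs , p) → x , xs , p })
       (searchA λ x → search-Vec searchA n λ xs → P? (x ∷ xs))

least : ∀ {P : ℕ → Set} → (∀ k → Dec (P k)) → ∀ n → P n → ∃[ r ] (r ≤ n × P r × (∀ k → P k → r ≤ k))
least P? zero p = zero , z≤n , p , λ _ _ → z≤n
least {P} P? (suc n) p with P? 0
... | yes p₀ = zero , z≤n , p₀ , λ _ _ → z≤n
... | no ¬p₀ = let (r , r≤n , pr , min) = least (P? ∘ suc) n p in
  suc r , s≤s r≤n , pr , λ { zero p₀ → contradiction p₀ ¬p₀ ; (suc k) pk → s≤s (min k pk) }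

triple : ∀ {A : Set} → A → A → A → Fin 3 → A
triple a b c zero = a
triple a b c (suc zero) = b
triple a b c (suc (suc zero)) = c

triple-η : ∀ {A : Set} (s : Fin 3 → A) i → triple (s zero) (s (suc zero)) (s (suc (suc zero))) i ≡ s i
triple-η s zero = refl
triple-η s (suc zero) = refl
triple-η s (suc (suc zero)) = refl

module _ {N : ℕ} (G : Graph N) where

  -- A colouring table over k + 1 colours, where colour k marks the edges that are never picked.
  Table : ℕ → Set
  Table k = Vec (Vec (Fin (suc k)) N) N

  entry : ∀ {k} → Table k → Fin N → Fin N → ℕ
  entry M u v = toℕ (lookup (lookup M u) v)

  choose : ∀ {k} → Vec (Fin N × Fin N) k → Fin N → ℕ → Fin N × Fin N
  choose {k} es v c with c <? k
  ... | yes c<k = lookup es (fromℕ< c<k)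
  -- A default for the colours from `k` on, which are never picked.
  ... | no _ = v , v

  Joined : ∀ {k} → Table k → (Fin 3 → Fin N) → Set
  Joined {k} M s = Σ[ es ∈ Vec (Fin N × Fin N) k ] (∀ i j → Star (Picked (Adj G) (entry M) k (choose es (s zero))) (s i) (s j))

  FiniteRainbow₃ : ℕ → Set
  FiniteRainbow₃ k = Σ[ M ∈ Table k ] ((∀ u v → entry M u v ≡ entry M v u) ×
    (∀ a b c → a ∈ V G → b ∈ V G → c ∈ V G → Joined M (triple a b c)))

  finiteRainbow₃? : ∀ k → Dec (FiniteRainbow₃ k)
  finiteRainbow₃? k = search-Vec (search-Vec F.any? N) N λ M →
    F.all? (λ u → F.all? λ v → entry M u v ≟ entry M v u) ×-dec
    F.all? (λ a → F.all? λ b → F.all? λ c →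
      (a S.∈? V G) →-dec ((b S.∈? V G) →-dec ((c S.∈? V G) →-dec
        search-Vec (search-× F.any? F.any?) k λ es → F.all? λ i → F.all? λ j →
          star? (picked? M (choose es a)) (triple a b c i) (triple a b c j))))
    where
    _≟²_ : DecidableEquality (Fin N × Fin N)
    _≟²_ = ≡-dec F._≟_ F._≟_
    picked? : ∀ M pick u v → Dec (Picked (Adj G) (entry M) k pick u v)
    picked? M pick u v = T? (adj G u v) ×-dec (entry M u v <? k ×-dec
      ((pick (entry M u v) ≟² (u , v)) ⊎-dec (pick (entry M u v) ≟² (v , u))))

  finite⇒rainbow₃ : ∀ {k} → FiniteRainbow₃ k → Rainbow₃ (_∈ V G) (Adj G) k
  finite⇒rainbow₃ {k} (M , M-sym , joined) = record
    { γ = entry M ; γ-sym = M-sym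
    ; join = λ s s∈ → let (es , walk) = joined _ _ _ (s∈ zero) (s∈ (suc zero)) (s∈ (suc (suc zero))) in
        choose es (s zero) , λ i j → subst₂ (Star _) (triple-η s i) (triple-η s j) (walk i j) }

  rainbow₃⇒finite : ∀ {k} → Rainbow₃ (_∈ V G) (Adj G) k → FiniteRainbow₃ k
  rainbow₃⇒finite {k} rb = M , M-sym , λ a b c a∈ b∈ c∈ →
      let (pick , walk) = join (triple a b c) λ { zero → a∈ ; (suc zero) → b∈ ; (suc (suc zero)) → c∈ } in
      tabulate (pick ∘ toℕ) , λ i j → Star.map (convert pick a) (walk i j)
    where
    open Rainbow₃ rb
    clip : ℕ → Fin (suc k)
    clip n = fromℕ< (s≤s (ℕ.m⊓n≤n n k))
    M : Table k
    M = tabulate λ u → tabulate λ v → clip (γ u v)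
    entry≡ : ∀ u v → entry M u v ≡ γ u v ⊓ k
    entry≡ u v = trans (cong toℕ (trans (cong (λ row → lookup row v) (V.lookup∘tabulate (λ u → tabulate λ v → clip (γ u v)) u))
                                        (V.lookup∘tabulate (λ v → clip (γ u v)) v)))
                       (F.toℕ-fromℕ< (s≤s (ℕ.m⊓n≤n (γ u v) k)))
    M-sym : ∀ u v → entry M u v ≡ entry M v u
    M-sym u v = trans (entry≡ u v) (trans (cong (_⊓ k) (γ-sym u v)) (sym (entry≡ v u)))
    choose-tabulate : ∀ pick a {c} → c < k → choose {k} (tabulate (pick ∘ toℕ)) a c ≡ pick c
    choose-tabulate pick a {c} c<k with c <? k
    ... | yes c<k′ = trans (V.lookup∘tabulate (pick ∘ toℕ) (fromℕ< c<k′)) (cong pick (F.toℕ-fromℕ< c<k′))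
    ... | no c≮k = contradiction c<k c≮k
    convert : ∀ pick a {u v} → Picked (Adj G) γ k pick u v →
              Picked (Adj G) (entry M) k (choose {k} (tabulate (pick ∘ toℕ)) a) u v
    convert pick a {u} {v} (e , <k , eq) =
      e , subst (_< k) (sym entry≡γ) <k , [ (λ p → inj₁ (trans chosen p)) , (λ p → inj₂ (trans chosen p)) ]′ eq
      where
      entry≡γ = trans (entry≡ u v) (ℕ.m≤n⇒m⊓n≡m (ℕ.<⇒≤ <k))
      chosen = trans (cong (choose {k} (tabulate (pick ∘ toℕ)) a) entry≡γ) (choose-tabulate pick a <k)

  rainbow₃? : ∀ k → Dec (Rainbow₃ (_∈ V G) (Adj G) k)
  rainbow₃? k = map′ finite⇒rainbow₃ rainbow₃⇒finite (finiteRainbow₃? k)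

-- Rainbow connections and 3-rainbow colourings

pair-≡ : ∀ {A : Set} {u v x y : A} → (u , v) ≡ (x , y) → u ≡ x × v ≡ y
pair-≡ refl = refl , refl

same-edge : ∀ {A : Set} {p : A × A} {u v x y : A} → p ≡ (u , v) ⊎ p ≡ (v , u) → p ≡ (x , y) ⊎ p ≡ (y , x) →
            (u ≡ x × v ≡ y) ⊎ (u ≡ y × v ≡ x)
same-edge (inj₁ refl) (inj₁ eq) = inj₁ (pair-≡ eq)
same-edge (inj₁ refl) (inj₂ eq) = inj₂ (pair-≡ eq)
same-edge (inj₂ refl) (inj₁ eq) = inj₂ (swap (pair-≡ eq))
same-edge (inj₂ refl) (inj₂ eq) = inj₁ (swap (pair-≡ eq))

module _ {N : ℕ} {G : Graph N} where

  -- Colours outside the palette become 0. The repetition is harmless, since edges with such colours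
  -- are never picked.
  clip : ∀ {k} → ℕ → Fin (suc k)
  clip {k} n with n <? suc k
  ... | yes n<k = fromℕ< n<k
  ... | no _ = zero

  toℕ-clip : ∀ {k n} → n < suc k → toℕ (clip {k} n) ≡ n
  toℕ-clip {k} {n} n<k with n <? suc k
  ... | yes n<k′ = F.toℕ-fromℕ< n<k′
  ... | no n≮k = contradiction n<k n≮k

  -- Clipping needs a nonempty palette. Without colours nothing can be picked, so the ends of an
  -- edge could not be connected.
  no-colours : Rainbow₃ (_∈ V G) (Adj G) 0 → ∀ {u v} → ¬ Adj G u v
  no-colours rb {u} {v} e =
    let (pick , walk) = join (triple u v v) ends in
    unequal pick (λ { refl → adj-irrefl G e }) (walk zero (suc zero))
    where
    open Rainbow₃ rb
    ends : ∀ i → triple u v v i ∈ V G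
    ends zero = adj-V G e
    ends (suc zero) = adj-V′ G e
    ends (suc (suc zero)) = adj-V′ G e
    unequal : ∀ pick {a b} → a ≢ b → ¬ Star (Picked (Adj G) γ 0 pick) a b
    unequal _ a≢b ε = a≢b refl
    unequal _ a≢b ((_ , () , _) ◅ _)

  colouring : ∀ k (rb : Rainbow₃ (_∈ V G) (Adj G) k) → let open Rainbow₃ rb in
              Σ[ c ∈ EdgeColoring G k ] (∀ {u v} (e : Adj G u v) → γ u v < k → toℕ (col c e) ≡ γ u v)
  colouring zero rb =
    record { col = λ e → ⊥-elim (no-colours rb e) ; col-sym = λ e → ⊥-elim (no-colours rb e) } , λ e → ⊥-elim (no-colours rb e)
  colouring (suc k) rb =
    record { col = λ {u} {v} _ → clip (γ u v) ; col-sym = λ {u} {v} _ → cong clip (γ-sym v u) } , λ _ → toℕ-clip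
    where open Rainbow₃ rb

  module FromRainbow₃ {k} (rb : Rainbow₃ (_∈ V G) (Adj G) k) where

    open Rainbow₃ rb

    c : EdgeColoring G k
    c = proj₁ (colouring k rb)

    -- All edges of the tree are picked, and two picked edges of the same colour are the same pick.
    is3RainbowColouring : Is3RainbowColoring c
    is3RainbowColouring p p⊆ ∣p∣≡3 = H , H⊑G , tree , rainbow , p⊆H
      where
      enum : Σ[ s ∈ (Fin 3 → Fin N) ] ((∀ i → s i ∈ p) × (∀ {v} → v ∈ p → ∃[ i ] s i ≡ v))
      enum = subst (λ n → Σ[ s ∈ (Fin n → Fin N) ] ((∀ i → s i ∈ p) × (∀ {v} → v ∈ p → ∃[ i ] s i ≡ v))) ∣p∣≡3 (enumerate p)
      s = proj₁ enum
      selection = join s (λ i → p⊆ (proj₁ (proj₂ enum) i))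
      pick = proj₁ selection
      through = tree-through (picked-sym (Adj G) (adj-sym G) γ γ-sym k pick) (s zero) 3 s (λ i → proj₂ selection zero i)
      open TreeWithin (proj₁ through)
      vertex∈ : ∀ {v} → v ∈ V H → v ∈ V G
      vertex∈ {v} v∈ with proj₂ (proj₁ tree) v∈ (proj₁ (proj₂ through))
      ... | ε = p⊆ (proj₁ (proj₂ enum) zero)
      ... | e ◅ _ = adj-V G (proj₁ (edges e))
      H⊑G : H ⊑ G
      H⊑G = record { V-⊆ = vertex∈ ; Adj-⊆ = λ e → proj₁ (edges e) }
      rainbow : Rainbow c H H⊑G
      rainbow {u} {v} {x} {y} e f eq =
        let (_ , <k , pe) = edges e
            (_ , <k′ , pf) = edges f
            γ≡ : γ u v ≡ γ x y
            γ≡ = trans (sym (proj₂ (colouring k rb) _ <k)) (trans (cong toℕ eq) (proj₂ (colouring k rb) _ <k′))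
        in same-edge pe (subst (λ n → pick n ≡ (x , y) ⊎ pick n ≡ (y , x)) (sym γ≡) pf)
      p⊆H : p ⊆ V H
      p⊆H v∈ with proj₂ (proj₂ enum) v∈
      ... | i , refl = proj₂ (proj₂ through) i

  module ToRainbow₃ {k} (3≤n : 3 ≤ order G) (c : EdgeColoring G k) (c-rainbow : Is3RainbowColoring c) where

    γ : Fin N → Fin N → ℕ
    γ u v with T? (adj G u v)
    ... | yes e = toℕ (col c e)
    ... | no _ = 0

    γ-col : ∀ {u v} (e : Adj G u v) → γ u v ≡ toℕ (col c e)
    γ-col {u} {v} e with T? (adj G u v)
    ... | yes e′ = cong (toℕ ∘ col c) (T-irrelevant e′ e)
    ... | no ¬e = contradiction e ¬e

    γ-sym : ∀ u v → γ u v ≡ γ v u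
    γ-sym u v with T? (adj G u v)
    ... | yes e = trans (cong toℕ (sym (col-sym c e))) (sym (γ-col (adj-sym G e)))
    ... | no ¬e with T? (adj G v u)
    ...   | yes e = contradiction (adj-sym G e) ¬e
    ...   | no _ = refl

    module _ (s : Fin 3 → Fin N) (s∈ : ∀ i → s i ∈ V G) where

      span : Subset N
      span = ⁅ s zero ⁆ ∪ (⁅ s (suc zero) ⁆ ∪ ⁅ s (suc (suc zero)) ⁆)

      s∈span : ∀ i → s i ∈ span
      s∈span zero = S.x∈p∪q⁺ (inj₁ (S.x∈⁅x⁆ _))
      s∈span (suc zero) = S.x∈p∪q⁺ (inj₂ (S.x∈p∪q⁺ (inj₁ (S.x∈⁅x⁆ _))))
      s∈span (suc (suc zero)) = S.x∈p∪q⁺ (inj₂ (S.x∈p∪q⁺ (inj₂ (S.x∈⁅x⁆ _))))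

      span⊆ : span ⊆ V G
      span⊆ v∈ with S.x∈p∪q⁻ ⁅ s zero ⁆ _ v∈
      ... | inj₁ v∈₀ = subst (_∈ V G) (sym (S.x∈⁅y⁆⇒x≡y _ v∈₀)) (s∈ zero)
      ... | inj₂ v∈′ with S.x∈p∪q⁻ ⁅ s (suc zero) ⁆ _ v∈′
      ...   | inj₁ v∈₁ = subst (_∈ V G) (sym (S.x∈⁅y⁆⇒x≡y _ v∈₁)) (s∈ (suc zero))
      ...   | inj₂ v∈₂ = subst (_∈ V G) (sym (S.x∈⁅y⁆⇒x≡y _ v∈₂)) (s∈ (suc (suc zero)))

      ∣span∣≤3 : ∣ span ∣ ≤ 3
      ∣span∣≤3 = ℕ.≤-trans (∣p∪q∣≤∣p∣+∣q∣ ⁅ s zero ⁆ _)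
        (ℕ.+-mono-≤ (ℕ.≤-reflexive (S.∣⁅x⁆∣≡1 (s zero))) (ℕ.≤-trans (∣p∪q∣≤∣p∣+∣q∣ ⁅ s (suc zero) ⁆ _)
          (ℕ.≤-reflexive (cong₂ _+_ (S.∣⁅x⁆∣≡1 (s (suc zero))) (S.∣⁅x⁆∣≡1 (s (suc (suc zero))))))))

      module _ (H : Graph N) (H⊑G : H ⊑ G) (rainbow : Rainbow c H H⊑G) where

        coloured? : ∀ n → Dec (∃[ u ] ∃[ v ] (Adj H u v × γ u v ≡ n))
        coloured? n = F.any? λ u → F.any? λ v → T? (adj H u v) ×-dec γ u v ≟ n

        pick : ℕ → Fin N × Fin N
        pick n with coloured? n
        ... | yes (u , v , _) = u , v
        ... | no _ = s zero , s zero

        pick-edge : ∀ {u v} → Adj H u v → pick (γ u v) ≡ (u , v) ⊎ pick (γ u v) ≡ (v , u)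
        pick-edge {u} {v} e with coloured? (γ u v)
        ... | no none = contradiction (u , v , e , refl) none
        ... | yes (x , y , f , eq)
          with rainbow f e (F.toℕ-injective (trans (sym (γ-col (Adj-⊆ H⊑G f))) (trans eq (γ-col (Adj-⊆ H⊑G e)))))
        ...   | inj₁ (refl , refl) = inj₁ refl
        ...   | inj₂ (refl , refl) = inj₂ refl

        picked : ∀ {u v} → Adj H u v → Picked (Adj G) γ k pick u v
        picked e = Adj-⊆ H⊑G e , subst (_< k) (sym (γ-col (Adj-⊆ H⊑G e))) (F.toℕ<n _) , pick-edge e

      selection : Σ[ pick ∈ (ℕ → Fin N × Fin N) ] (∀ i j → Star (Picked (Adj G) γ k pick) (s i) (s j))
      selection =
        -- Coinciding terminals span fewer than three vertices; `3 ≤ order G` leaves room to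
        -- complete them to a set of exactly three.
        let (p , span⊆p , p⊆ , ∣p∣≡3) = ⊆-extend span (V G) 3 span⊆ ∣span∣≤3 3≤n
            (H , H⊑G , tree , rainbow , p⊆H) = c-rainbow p p⊆ ∣p∣≡3
        in pick H H⊑G rainbow , λ i j →
             Star.map (picked H H⊑G rainbow) (proj₂ (proj₁ tree) (p⊆H (span⊆p (s∈span i))) (p⊆H (span⊆p (s∈span j))))

    rainbow₃ : Rainbow₃ (_∈ V G) (Adj G) k
    rainbow₃ = record { γ = γ ; γ-sym = γ-sym ; join = selection }

-- The least `k` admitting `Rainbow₃` exists by decidability, and translating colourings in both
-- directions makes it the rainbow index.
rainbow-index : ∀ {N} (G : Graph N) {d} → 3 ≤ order G → Deficient G d → ∃[ r ] (IsRainbowIndex₃ G r × r + d ≤ order G)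
rainbow-index G {d} 3≤n (deficient {k} rb k+d≤n) =
  let (r , r≤k , rb′ , minimal) = least (rainbow₃? G) k rb
      module From = FromRainbow₃ rb′
  in r , ((From.c , From.is3RainbowColouring) ,
          λ k′ c c-rainbow → minimal k′ (ToRainbow₃.rainbow₃ 3≤n c c-rainbow)) ,
     ℕ.≤-trans (ℕ.+-monoˡ-≤ d r≤k) k+d≤n

-- The bound and its sharpness

open import Data.Integer using (+_) renaming (_-_ to _-ℤ_; _*_ to _*ℤ_; _≤_ to _≤ℤ_; _+_ to _+ℤ_)
import Data.Integer.Properties as ℤ
import Data.Integer.Tactic.RingSolver as ℤ

indicator : Bool → ℕ
indicator b = if b then 1 else 0

∣∷∣ : ∀ {n} b (p : Subset n) → ∣ b ∷ p ∣ ≡ indicator b + ∣ p ∣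
∣∷∣ true p = refl
∣∷∣ false p = refl

sum-indicators : ∀ {q} (C D : Subset q) →
  sum (List.tabulate (λ i → indicator (lookup C i) + 2 * indicator (lookup D i))) ≡ ∣ C ∣ + 2 * ∣ D ∣
sum-indicators [] [] = refl
sum-indicators (c ∷ C) (d ∷ D)
  rewrite sum-indicators C D | ∣∷∣ c C | ∣∷∣ d D = rearrange (indicator c) (indicator d) ∣ C ∣ ∣ D ∣
  where
  rearrange : ∀ a b c d → a + 2 * b + (c + 2 * d) ≡ a + c + 2 * (b + d)
  rearrange = solve-∀

-- No block is counted in both classes: a member of 𝒟 is neither a cycle nor of order at most 6.
saved : ∀ {N} {X : Graph N} c d → (T c → InClassC X) → (T d → InClassD X) → Saves X (indicator c + 2 * indicator d)
saved false false _ _ = saves-0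
saved false true _ inD = let (¬cycle , 7≤) = inD tt in saves-2 ¬cycle 7≤
saved true false inC _ = saves-1 ([ proj₂ , proj₁ ]′ (inC tt))
saved true true inC inD =
  let (¬cycle , 7≤) = inD tt in
  ⊥-elim ([ (λ (cycle , _) → ¬cycle cycle) , (λ (_ , ≤6) → ℕ.<⇒≱ 7≤ ≤6) ]′ (inC tt))

T-lookup : ∀ {q} (p : Subset q) {i} → T (lookup p i) → i ∈ p
T-lookup p {i} t with lookup p i in eq
... | true = V.lookup⇒[]= i p eq

bound-ℤ : ∀ r n c d → r + suc (c + 2 * d) ≤ n → + r ≤ℤ + n -ℤ + c -ℤ + 2 *ℤ + d -ℤ + 1
bound-ℤ r n c d le with ℕ.m≤n⇒∃[o]m+o≡n le
... | o , refl = subst (+ r ≤ℤ_) (sym cancelled) (ℤ.i≤i+j (+ r) (+ o))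
  where
  expand-pos : + (r + suc (c + 2 * d) + o) ≡ (+ r +ℤ (+ 1 +ℤ (+ c +ℤ + 2 *ℤ + d))) +ℤ + o
  expand-pos = trans (ℤ.pos-+ (r + suc (c + 2 * d)) o) (cong (_+ℤ + o) (trans (ℤ.pos-+ r (suc (c + 2 * d))) (cong (+ r +ℤ_)
    (trans (ℤ.pos-+ 1 (c + 2 * d)) (cong (+ 1 +ℤ_) (trans (ℤ.pos-+ c (2 * d)) (cong (+ c +ℤ_) (ℤ.pos-* 2 d))))))))
  identity : ∀ r c d o → (r +ℤ (+ 1 +ℤ (c +ℤ + 2 *ℤ d))) +ℤ o -ℤ c -ℤ + 2 *ℤ d -ℤ + 1 ≡ r +ℤ o
  identity = ℤ.solve-∀
  cancelled : + (r + suc (c + 2 * d) + o) -ℤ + c -ℤ + 2 *ℤ + d -ℤ + 1 ≡ + r +ℤ + o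
  cancelled = trans (cong (λ z → z -ℤ + c -ℤ + 2 *ℤ + d -ℤ + 1) expand-pos) (identity (+ r) (+ c) (+ d) (+ o))

upper-bound : ∀ {N : ℕ} (G : Graph N) → Connected G → 3 ≤ order G →
              ∀ {q : ℕ} (B : Fin q → Graph N) → IsBlockDecomposition G B →
              ∀ (C D : Subset q) → Selects C B InClassC → Selects D B InClassD →
              ∃[ r ] (IsRainbowIndex₃ G r × + r ≤ℤ + order G -ℤ + ∣ C ∣ -ℤ + 2 *ℤ + ∣ D ∣ -ℤ + 1)
upper-bound G connected 3≤n {q} B decomposition C D selC selD =
  let (r , index , r+d≤n) = rainbow-index G 3≤n deficit
  in r , index , bound-ℤ r (order G) ∣ C ∣ ∣ D ∣ (subst (λ d → r + suc d ≤ order G) weight≡ r+d≤n)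
  where
  open IsBlockDecomposition decomposition
  w : Fin q → ℕ
  w i = indicator (lookup C i) + 2 * indicator (lookup D i)
  open Blocks B distinct w (λ i → saved (lookup C i) (lookup D i)
    (Equivalence.to (selC i) ∘ T-lookup C) (Equivalence.to (selD i) ∘ T-lookup D))
  deficit : Deficient G (suc (weight (allFin q)))
  deficit = blocks-deficient (order G) ℕ.≤-refl connected (allFin q) (Unique.allFin⁺ q) (All.tabulate⁺ isBlock)
  weight≡ : weight (allFin q) ≡ ∣ C ∣ + 2 * ∣ D ∣
  weight≡ = trans (cong sum (List.map-tabulate id w)) (sum-indicators C D)

K₃ : Graph 3
K₃ = record
  { V = full
  ; adj = λ u v → ⌊ ¬? (u F.≟ v) ⌋
  ; adj-sym = λ {u} {v} e → fromWitness {a? = ¬? (v F.≟ u)} (toWitness {a? = ¬? (u F.≟ v)} e ∘ sym)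
  ; adj-irrefl = λ {u} e → toWitness {a? = ¬? (u F.≟ u)} e refl
  ; adj-V = λ _ → S.∈⊤ }

K₃-adj : ∀ {u v} → u ≢ v → Adj K₃ u v
K₃-adj {u} {v} = fromWitness {a? = ¬? (u F.≟ v)}

K₃-nocut : NoCut K₃
K₃-nocut x {u} {v} _ _ u≢x v≢x with u F.≟ v
... | yes refl = ε
... | no u≢v = (K₃-adj u≢v , u≢x , v≢x) ◅ ε

K₃-connected : Connected K₃
K₃-connected = (zero , S.∈⊤) , λ {u} {v} _ _ → walk u v
  where
  walk : ∀ u v → Star (Adj K₃) u v
  walk u v with u F.≟ v
  ... | yes refl = ε
  ... | no u≢v = K₃-adj u≢v ◅ ε

-- With at most one colour a rainbow tree has at most one edge, which cannot meet all three vertices.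
K₃-needs-two : ∀ {k} → Rainbow₃ (_∈ V K₃) (Adj K₃) k → 2 ≤ k
K₃-needs-two {k} rb with 2 ≤? k
... | yes 2≤k = 2≤k
... | no 2≰k = ⊥-elim (case join id (λ _ → S.∈⊤) of λ (pick , walk) → three-in-two (pick 0)
        (touches pick (λ ()) (walk zero (suc zero))) (touches pick (λ ()) (walk (suc zero) zero))
        (touches pick (λ ()) (walk (suc (suc zero)) zero)))
  where
  open Rainbow₃ rb
  touches : ∀ pick {u v} → u ≢ v → Star (Picked (Adj K₃) γ k pick) u v → u ≡ proj₁ (pick 0) ⊎ u ≡ proj₂ (pick 0)
  touches pick u≢v ε = contradiction refl u≢v
  touches pick {u} u≢v (_◅_ {j = w} (_ , <k , eq) _) with γ u w | ℕ.n<1⇒n≡0 (ℕ.<-≤-trans <k (ℕ.≤-pred (ℕ.≰⇒> 2≰k)))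
  ... | _ | refl = [ (λ p → inj₁ (sym (cong proj₁ p))) , (λ p → inj₂ (sym (cong proj₂ p))) ]′ eq
  three-in-two : ∀ ((x , y) : Fin 3 × Fin 3) → zero ≡ x ⊎ zero ≡ y → suc zero ≡ x ⊎ suc zero ≡ y →
                 suc (suc zero) ≡ x ⊎ suc (suc zero) ≡ y → ⊥
  three-in-two _ (inj₁ refl) (inj₂ refl) (inj₁ ())
  three-in-two _ (inj₁ refl) (inj₂ refl) (inj₂ ())
  three-in-two _ (inj₂ refl) (inj₁ refl) (inj₁ ())
  three-in-two _ (inj₂ refl) (inj₁ refl) (inj₂ ())

K₃-index : ∃[ r ] (IsRainbowIndex₃ K₃ r × + r ≡ + 2)
K₃-index =
  let (r , index@((c , c-rainbow) , _) , r+1≤3) = rainbow-index K₃ ℕ.≤-refl (deficient₁ K₃ K₃-connected K₃-nocut)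
  in r , index , cong +_ (ℕ.≤-antisym (ℕ.≤-pred (subst (_≤ 3) (ℕ.+-comm r 1) r+1≤3))
                                     (K₃-needs-two (ToRainbow₃.rainbow₃ ℕ.≤-refl c c-rainbow)))

K₃-decomposition : IsBlockDecomposition K₃ {1} (λ _ → K₃)
K₃-decomposition = record
  { isBlock = λ _ → whole , ok , λ _ Y⊑ _ _ → Y⊑
  ; distinct = λ { {zero} {zero} _ → refl }
  ; complete = λ X (X⊑ , _ , maximal) → zero , maximal K₃ whole ok X⊑ , X⊑ }
  where
  whole : K₃ ⊑ K₃
  whole = record { V-⊆ = id ; Adj-⊆ = id }
  ok : ConnectedWithoutCutVertex K₃
  ok = K₃-connected , NoCut⇒no-cut-vertex K₃ K₃-nocut

theorem4p1 : (∀ {N : ℕ} (G : Graph N) → Connected G → 3 ≤ order G →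
    ∀ {q : ℕ} (B : Fin q → Graph N) → IsBlockDecomposition G B →
    ∀ (C D : Subset q) → Selects C B InClassC → Selects D B InClassD →
    ∃[ r ] (IsRainbowIndex₃ G r ×
    + r ≤ℤ + order G -ℤ + ∣ C ∣ -ℤ + 2 *ℤ + ∣ D ∣ -ℤ + 1))
    ×
    (Σ[ N ∈ ℕ ] Σ[ G ∈ Graph N ] (Connected G × 3 ≤ order G ×
    Σ[ q ∈ ℕ ] Σ[ B ∈ (Fin q → Graph N) ] (IsBlockDecomposition G B ×
    Σ[ C ∈ Subset q ] Σ[ D ∈ Subset q ] (Selects C B InClassC × Selects D B InClassD ×
    ∃[ r ] (IsRainbowIndex₃ G r ×
    + r ≡ + order G -ℤ + ∣ C ∣ -ℤ + 2 *ℤ + ∣ D ∣ -ℤ + 1)))))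
theorem4p1 =
  upper-bound ,
  -- The only block has order 3 and belongs to neither class, so the bound is 3 - 1 = 2.
  3 , K₃ , K₃-connected , ℕ.≤-refl , 1 , (λ _ → K₃) , K₃-decomposition , empty , empty ,
  (λ _ → mk⇔ (λ i∈ → contradiction i∈ S.∉⊥) λ { (inj₁ (_ , s≤s (s≤s (s≤s ())))) ; (inj₂ (s≤s (s≤s (s≤s ())) , _)) }) ,
  (λ _ → mk⇔ (λ i∈ → contradiction i∈ S.∉⊥) λ { (_ , s≤s (s≤s (s≤s ()))) }) ,
  K₃-index
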